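{- Let $d,n\ge 1$ be integers, $r>0$, $\beta>0$, and let $x_1,x_2,\ldots,x_n\in\mathbb{R}^d$. Let $N_\beta=\big|\{(i,j):1\le i<j\le n,\ \Vert x_i-x_j\Vert_2\le \beta r\}\big|$. Then for every $x_0\in\mathbb{R}^d$, $$\max_{1\le i\le n}\Vert x_i-x_0\Vert_2\ \ge\ \frac12\left(\left(\frac{n^2}{2N_\beta+n}\right)^{\frac1d}-1\right)\beta r .$$
   Context: $\Vert\cdot\Vert_2$ is the Euclidean norm on $\mathbb{R}^d$. $N_\beta$ is the number of $\beta r$-near pairs among the points (unordered pairs of distinct indices). -}

module Defs where

open import Data.Fin.Base as Fin using (Fin)
open import Data.Integer.Base as ℤ using (+_)
import Data.Integer.Properties as ℤ
open import Data.List.Base using (length)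
open import Data.List.Membership.Propositional using (_∈_)
open import Data.List.Relation.Unary.Unique.Propositional using (Unique)
open import Data.Nat.Coprimality using (1-coprimeTo) renaming (sym to sym-coprime)
open import Data.Nat.Base as ℕ using (ℕ; zero; suc; NonZero)
import Data.Nat.Properties as ℕ
open import Data.Product using (∃; ∃-syntax; _×_; _,_; proj₁; proj₂)
open import Data.Rational.Base as ℚ using (ℚ; 0ℚ; 1ℚ; ½)
import Data.Rational.Properties as ℚ
import Data.Rational.Unnormalised.Base as ℚᵘ
import Data.Rational.Unnormalised.Properties as ℚᵘ
open import Data.Sum.Base using (_⊎_; inj₁; inj₂; [_,_]′)
open import Data.Vec.Functional using (Vector; foldr; map; zipWith; head; tail)
open import Function.Bundles using (_⇔_)
open import Relation.Binary.PropositionalEquality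
open import Relation.Nullary using (Dec; yes; no; contradiction)

module RationalLemmas where

  open import Algebra.Definitions.RawMonoid ℚ.+-0-rawMonoid using () renaming (_×_ to _·_)
  open import Algebra.Definitions.RawSemiring ℚ.+-*-rawSemiring public using (_^_)
  open import Data.Rational.Base hiding (NonZero)
  open import Data.Rational.Solver using (module +-*-Solver)
  open +-*-Solver using (solve; _:=_; _:+_; _:*_; _:-_; :-_)

  module ≤R = ℚ.≤-Reasoning

  0<1 : 0ℚ < 1ℚ
  0<1 = ℚ.positive⁻¹ 1ℚ

  *-pos : ∀ {p q} → 0ℚ < p → 0ℚ < q → 0ℚ < p * q
  *-pos {p} {q} 0<p 0<q =
    ℚ.positive⁻¹ (p * q) {{ℚ.pos*pos⇒pos p {{positive 0<p}} q {{positive 0<q}}}}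

  *-nonNeg : ∀ {p q} → 0ℚ ≤ p → 0ℚ ≤ q → 0ℚ ≤ p * q
  *-nonNeg {p} {q} 0≤p 0≤q =
    ℚ.nonNegative⁻¹ (p * q)
      {{ℚ.nonNeg*nonNeg⇒nonNeg p {{nonNegative 0≤p}} q {{nonNegative 0≤q}}}}

  *-mono-≤ : ∀ {p q r s} → 0ℚ ≤ q → 0ℚ ≤ r → p ≤ q → r ≤ s → p * r ≤ q * s
  *-mono-≤ {p} {q} {r} {s} 0≤q 0≤r p≤q r≤s = ℚ.≤-trans
    (ℚ.*-monoʳ-≤-nonNeg r {{nonNegative 0≤r}} p≤q)
    (ℚ.*-monoˡ-≤-nonNeg q {{nonNegative 0≤q}} r≤s)

  half-pos : ∀ {ε} → 0ℚ < ε → 0ℚ < ½ * ε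
  half-pos = *-pos (ℚ.positive⁻¹ ½)

  half+half : ∀ ε → ½ * ε + ½ * ε ≡ ε
  half+half ε = trans (sym (ℚ.*-distribʳ-+ ε ½ ½)) (ℚ.*-identityˡ ε)

  p≤p+q : ∀ {p q} → 0ℚ ≤ q → p ≤ p + q
  p≤p+q {p} {q} 0≤q = subst (_≤ p + q) (ℚ.+-identityʳ p) (ℚ.+-monoʳ-≤ p 0≤q)

  p≤∣p∣ : ∀ p → p ≤ ∣ p ∣
  p≤∣p∣ p with ℚ.≤-total 0ℚ p
  ... | inj₁ 0≤p = ℚ.≤-reflexive (sym (ℚ.0≤p⇒∣p∣≡p 0≤p))
  ... | inj₂ p≤0 = ℚ.≤-trans p≤0 (ℚ.0≤∣p∣ p)

  near⇒< : ∀ p q {ε} → ∣ p - q ∣ < ε → p < q + ε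
  near⇒< p q {ε} h = begin-strict
    p            ≡⟨ solve 2 (λ p q → p := q :+ (p :- q)) refl p q ⟩
    q + (p - q)  <⟨ ℚ.+-monoʳ-< q (ℚ.≤-<-trans (p≤∣p∣ (p - q)) h) ⟩
    q + ε        ∎
    where open ≤R

  ∣p-q∣≡∣q-p∣ : ∀ p q → ∣ p - q ∣ ≡ ∣ q - p ∣
  ∣p-q∣≡∣q-p∣ p q = trans (sym (ℚ.∣-p∣≡∣p∣ (p - q)))
    (cong ∣_∣ (solve 2 (λ p q → :- (p :- q) := q :- p) refl p q))

  near⇒> : ∀ p q {ε} → ∣ p - q ∣ < ε → q < p + ε
  near⇒> p q {ε} h = near⇒< q p (subst (_< ε) (∣p-q∣≡∣q-p∣ p q) h)

  <⇒near : ∀ {p q ε} → p < q + ε → q < p + ε → ∣ p - q ∣ < ε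
  <⇒near {p} {q} {ε} p< q< with ℚ.∣p∣≡p∨∣p∣≡-p (p - q)
  ... | inj₁ eq rewrite eq = begin-strict
    p - q        <⟨ ℚ.+-monoˡ-< (- q) p< ⟩
    q + ε - q    ≡⟨ solve 2 (λ q ε → q :+ ε :- q := ε) refl q ε ⟩
    ε            ∎
    where open ≤R
  ... | inj₂ eq rewrite eq = begin-strict
    - (p - q)    ≡⟨ solve 2 (λ p q → :- (p :- q) := q :- p) refl p q ⟩
    q - p        <⟨ ℚ.+-monoˡ-< (- p) q< ⟩
    p + ε - p    ≡⟨ solve 2 (λ p ε → p :+ ε :- p := ε) refl p ε ⟩
    ε            ∎
    where open ≤R

  ⊔-<-+ : ∀ {p q p′ q′ ε} → p < p′ + ε → q < q′ + ε → p ⊔ q < p′ ⊔ q′ + ε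
  ⊔-<-+ {p} {q} {p′} {q′} {ε} p< q< with ℚ.⊔-sel p q
  ... | inj₁ eq rewrite eq = ℚ.<-≤-trans p< (ℚ.+-monoˡ-≤ ε (ℚ.p≤p⊔q p′ q′))
  ... | inj₂ eq rewrite eq = ℚ.<-≤-trans q< (ℚ.+-monoˡ-≤ ε (ℚ.p≤q⊔p p′ q′))

  ⊔-near : ∀ a b c d {ε} → ∣ a - c ∣ < ε → ∣ b - d ∣ < ε → ∣ a ⊔ b - (c ⊔ d) ∣ < ε
  ⊔-near a b c d {ε} ac bd = <⇒near
    (⊔-<-+ {a} {b} {c} {d} (near⇒< a c ac) (near⇒< b d bd))
    (⊔-<-+ {c} {d} {a} {b} (near⇒> a c ac) (near⇒> b d bd))

  ∣ab-cd∣≤ : ∀ a b c d → ∣ a * b - c * d ∣ ≤ ∣ a ∣ * ∣ b - d ∣ + ∣ d ∣ * ∣ a - c ∣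
  ∣ab-cd∣≤ a b c d = begin
    ∣ a * b - c * d ∣                      ≡⟨ cong ∣_∣ split ⟩
    ∣ a * (b - d) + d * (a - c) ∣          ≤⟨ ℚ.∣p+q∣≤∣p∣+∣q∣ (a * (b - d)) (d * (a - c)) ⟩
    ∣ a * (b - d) ∣ + ∣ d * (a - c) ∣      ≡⟨ cong₂ _+_ (ℚ.∣p*q∣≡∣p∣*∣q∣ a (b - d)) (ℚ.∣p*q∣≡∣p∣*∣q∣ d (a - c)) ⟩
    ∣ a ∣ * ∣ b - d ∣ + ∣ d ∣ * ∣ a - c ∣  ∎
    where
    open ≤R
    split : a * b - c * d ≡ a * (b - d) + d * (a - c)
    split = solve 4 (λ a b c d → a :* b :- c :* d := a :* (b :- d) :+ d :* (a :- c))
              refl a b c d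

  scale : ∀ {M ε} → 0ℚ < M → 0ℚ < ε → ∃[ δ ] (0ℚ < δ × M * δ ≡ ε)
  scale {M} {ε} 0<M 0<ε =
      1/ M * ε
    , *-pos (ℚ.positive⁻¹ (1/ M) {{ℚ.1/pos⇒pos M}}) 0<ε
    , trans (sym (ℚ.*-assoc M (1/ M) ε))
        (trans (cong (_* ε) (ℚ.*-inverseʳ M)) (ℚ.*-identityˡ ε))
    where instance
      M-pos : Positive M
      M-pos = positive 0<M
      M-nonZero : ℚ.NonZero M
      M-nonZero = ℚ.pos⇒nonZero M

  +-near : ∀ a b c d {ε} → ∣ a - c ∣ < ½ * ε → ∣ b - d ∣ < ½ * ε →
           ∣ (a + b) - (c + d) ∣ < ε
  +-near a b c d {ε} ac bd = begin-strict
    ∣ (a + b) - (c + d) ∣    ≡⟨ cong ∣_∣ (solve 4 (λ a b c d →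
                                  (a :+ b) :- (c :+ d) := (a :- c) :+ (b :- d)) refl a b c d) ⟩
    ∣ (a - c) + (b - d) ∣    ≤⟨ ℚ.∣p+q∣≤∣p∣+∣q∣ (a - c) (b - d) ⟩
    ∣ a - c ∣ + ∣ b - d ∣    <⟨ ℚ.+-mono-< ac bd ⟩
    ½ * ε + ½ * ε            ≡⟨ half+half ε ⟩
    ε                        ∎
    where open ≤R

  *-near : ∀ a b c d {A B α β ε} → 0ℚ < A → 0ℚ < B → A * β ≡ ½ * ε → B * α ≡ ½ * ε →
           ∣ a ∣ ≤ A → ∣ d ∣ ≤ B → ∣ a - c ∣ < α → ∣ b - d ∣ < β →
           ∣ a * b - c * d ∣ < ε
  *-near a b c d {A} {B} {α} {β} {ε} 0<A 0<B Aβ≡ Bα≡ ∣a∣≤A ∣d∣≤B ac bd = begin-strict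
    ∣ a * b - c * d ∣                      ≤⟨ ∣ab-cd∣≤ a b c d ⟩
    ∣ a ∣ * ∣ b - d ∣ + ∣ d ∣ * ∣ a - c ∣  <⟨ ℚ.+-mono-< (bound 0<A ∣a∣≤A bd) (bound 0<B ∣d∣≤B ac) ⟩
    A * β + B * α                          ≡⟨ cong₂ _+_ Aβ≡ Bα≡ ⟩
    ½ * ε + ½ * ε                          ≡⟨ half+half ε ⟩
    ε                                      ∎
    where
    open ≤R
    bound : ∀ {p q M γ} → 0ℚ < M → ∣ p ∣ ≤ M → ∣ q ∣ < γ → ∣ p ∣ * ∣ q ∣ < M * γ
    bound {p} {q} {M} 0<M ∣p∣≤M ∣q∣<γ = ℚ.≤-<-trans
      (ℚ.*-monoʳ-≤-nonNeg ∣ q ∣ {{nonNegative (ℚ.0≤∣p∣ q)}} ∣p∣≤M)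
      (ℚ.*-monoʳ-<-pos M {{positive 0<M}} ∣q∣<γ)

  ^-pos : ∀ {p} n → 0ℚ < p → 0ℚ < p ^ n
  ^-pos zero    0<p = 0<1
  ^-pos (suc n) 0<p = *-pos 0<p (^-pos n 0<p)

  ^-nonNeg : ∀ {p} n → 0ℚ ≤ p → 0ℚ ≤ p ^ n
  ^-nonNeg zero    0≤p = ℚ.<⇒≤ 0<1
  ^-nonNeg (suc n) 0≤p = *-nonNeg 0≤p (^-nonNeg n 0≤p)

  ^-mono-≤ : ∀ {p q} n → 0ℚ ≤ p → p ≤ q → p ^ n ≤ q ^ n
  ^-mono-≤ zero    0≤p p≤q = ℚ.≤-refl
  ^-mono-≤ (suc n) 0≤p p≤q =
    *-mono-≤ (ℚ.≤-trans 0≤p p≤q) (^-nonNeg n 0≤p) p≤q (^-mono-≤ n 0≤p p≤q)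

  ^-superadditive : ∀ {p q} n .{{_ : NonZero n}} → 0ℚ ≤ p → 0ℚ ≤ q →
                    p ^ n + q ^ n ≤ (p + q) ^ n
  ^-superadditive {p} {q} (suc zero) 0≤p 0≤q =
    ℚ.≤-reflexive (sym (ℚ.*-distribʳ-+ 1ℚ p q))
  ^-superadditive {p} {q} (suc n@(suc _)) 0≤p 0≤q = begin
    p * p ^ n + q * q ^ n
      ≤⟨ ℚ.+-mono-≤
           (ℚ.*-monoˡ-≤-nonNeg p {{nonNegative 0≤p}} (p≤p+q (^-nonNeg n 0≤q)))
           (ℚ.*-monoˡ-≤-nonNeg q {{nonNegative 0≤q}}
             (subst (q ^ n ≤_) (ℚ.+-comm (q ^ n) (p ^ n)) (p≤p+q (^-nonNeg n 0≤p)))) ⟩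
    p * (p ^ n + q ^ n) + q * (p ^ n + q ^ n)
      ≡⟨ ℚ.*-distribʳ-+ (p ^ n + q ^ n) p q ⟨
    (p + q) * (p ^ n + q ^ n)
      ≤⟨ ℚ.*-monoˡ-≤-nonNeg (p + q) {{nonNegative 0≤p+q}} (^-superadditive n 0≤p 0≤q) ⟩
    (p + q) * (p + q) ^ n
      ∎
    where
    open ≤R
    0≤p+q : 0ℚ ≤ p + q
    0≤p+q = ℚ.≤-trans 0≤p (p≤p+q 0≤q)

  1≤p⇒p≤p^n : ∀ {p} n .{{_ : NonZero n}} → 1ℚ ≤ p → p ≤ p ^ n
  1≤p⇒p≤p^n {p} (suc n) 1≤p = begin
    p          ≡⟨ ℚ.*-identityʳ p ⟨
    p * 1ℚ     ≤⟨ ℚ.*-monoˡ-≤-nonNeg p {{nonNegative 0≤p}} (1≤p^ n) ⟩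
    p * p ^ n  ∎
    where
    open ≤R
    0≤p : 0ℚ ≤ p
    0≤p = ℚ.≤-trans (ℚ.<⇒≤ 0<1) 1≤p
    1≤p^ : ∀ n → 1ℚ ≤ p ^ n
    1≤p^ zero    = ℚ.≤-refl
    1≤p^ (suc n) = *-mono-≤ 0≤p (ℚ.<⇒≤ 0<1) 1≤p (1≤p^ n)

  1/suc : ℕ → ℚ
  1/suc k = mkℚ (+ 1) k (1-coprimeTo (suc k))

  1/suc-pos : ∀ k → 0ℚ < 1/suc k
  1/suc-pos k = ℚ.positive⁻¹ (1/suc k)

  1/suc-vanishes : ∀ {ε} → 0ℚ < ε → ∃[ N ] (∀ k → N ℕ.≤ k → 1/suc k < ε)
  1/suc-vanishes {ε} 0<ε with positive 0<ε
  1/suc-vanishes {mkℚ (+ suc a) d _} 0<ε | _ = suc d , λ k d<k → *<* (ℤ.+<+ (begin-strict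
    1 ℕ.* suc d      ≡⟨ ℕ.*-identityˡ (suc d) ⟩
    suc d            <⟨ ℕ.s≤s d<k ⟩
    suc k            ≤⟨ ℕ.m≤n*m (suc k) (suc a) ⟩
    suc a ℕ.* suc k  ∎))
    where open ℕ.≤-Reasoning

  private
    fromℕ : ℕ → ℚ
    fromℕ n = mkℚ (+ n) 0 (sym-coprime (1-coprimeTo n))

    suc·1 : ∀ n → 1ℚ + fromℕ n ≡ fromℕ (suc n)
    suc·1 n = ℚ.toℚᵘ-injective (ℚᵘ.≃-trans (ℚ.toℚᵘ-homo-+ 1ℚ (fromℕ n))
      (ℚᵘ.*≡* (cong (λ m → (+ 1 ℤ.+ m) ℤ.* + 1) (ℤ.*-identityʳ (+ n)))))

    ·≡* : ∀ n p → n · p ≡ fromℕ n * p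
    ·≡* zero    p = sym (ℚ.*-zeroˡ p)
    ·≡* (suc n) p = begin
      p + n · p              ≡⟨ cong₂ _+_ (sym (ℚ.*-identityˡ p)) (·≡* n p) ⟩
      1ℚ * p + fromℕ n * p   ≡⟨ ℚ.*-distribʳ-+ p 1ℚ (fromℕ n) ⟨
      (1ℚ + fromℕ n) * p     ≡⟨ cong (_* p) (suc·1 n) ⟩
      fromℕ (suc n) * p      ∎
      where open ≡-Reasoning

    ≤fromℕ : ∀ p → p ≤ fromℕ ℤ.∣ ↥ p ∣
    ≤fromℕ p@(mkℚ (+ n) d _) = *≤* (subst₂ ℤ._≤_ (sym (ℤ.*-identityʳ (+ n))) (ℤ.pos-* n (suc d))
      (ℤ.+≤+ (ℕ.m≤m*n n (suc d))))
    ≤fromℕ p@(mkℚ ℤ.-[1+ n ] d _) = ℚ.≤-trans (ℚ.<⇒≤ (ℚ.negative⁻¹ p))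
      (ℚ.nonNegative⁻¹ (fromℕ (suc n)))

  archimedean : ∀ p {δ} → 0ℚ < δ → ∃[ n ] p ≤ n · δ
  archimedean p {δ} 0<δ with scale 0<δ 0<1
  ... | δ⁻¹ , _ , δδ⁻¹≡1 = n , (begin
    p              ≡⟨ ℚ.*-identityʳ p ⟨
    p * 1ℚ         ≡⟨ cong (p *_) δδ⁻¹≡1 ⟨
    p * (δ * δ⁻¹)  ≡⟨ solve 3 (λ p δ δ⁻¹ → p :* (δ :* δ⁻¹) := p :* δ⁻¹ :* δ) refl p δ δ⁻¹ ⟩
    p * δ⁻¹ * δ    ≤⟨ ℚ.*-monoʳ-≤-nonNeg δ {{nonNegative (ℚ.<⇒≤ 0<δ)}} (≤fromℕ (p * δ⁻¹)) ⟩
    fromℕ n * δ    ≡⟨ ·≡* n δ ⟨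
    n · δ          ∎)
    where
    open ≤R
    n = ℤ.∣ ↥ (p * δ⁻¹) ∣

  ApproxRoot : ℕ → ℚ → ℚ → ℚ → Set
  ApproxRoot d q δ ρ = 0ℚ ≤ ρ × ρ ^ d ≤ q × q < (ρ + δ) ^ d

  approxRoot : ∀ d .{{_ : NonZero d}} {q δ} → 0ℚ ≤ q → 0ℚ < δ → ∃ (ApproxRoot d q δ)
  approxRoot d@(suc d′) {q} {δ} 0≤q 0<δ =
    let n , q+1≤nδ = archimedean (q + 1ℚ) 0<δ in
    [ (λ root → root) , (λ nδ^d≤q → contradiction nδ^d≤q (nδ^d≰q n q+1≤nδ)) ]′ (search n)
    where
    0≤_·δ : ∀ n → 0ℚ ≤ n · δ
    0≤ zero  ·δ = ℚ.≤-refl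
    0≤ suc n ·δ = ℚ.≤-trans (ℚ.<⇒≤ 0<δ) (p≤p+q 0≤ n ·δ)

    step : ∀ n → (n · δ) ^ d ≤ q → Dec ((suc n · δ) ^ d ≤ q) →
           ∃ (ApproxRoot d q δ) ⊎ (suc n · δ) ^ d ≤ q
    step n nδ^d≤q (yes sucnδ^d≤q) = inj₂ sucnδ^d≤q
    step n nδ^d≤q (no  sucnδ^d≰q) = inj₁
      ( n · δ , 0≤ n ·δ , nδ^d≤q
      , subst (λ p → q < p ^ d) (ℚ.+-comm δ (n · δ)) (ℚ.≰⇒> sucnδ^d≰q) )

    search : ∀ n → ∃ (ApproxRoot d q δ) ⊎ (n · δ) ^ d ≤ q
    search zero    = inj₂ (subst (_≤ q) (sym (ℚ.*-zeroˡ (0ℚ ^ d′))) 0≤q)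
    search (suc n) =
      [ inj₁ , (λ nδ^d≤q → step n nδ^d≤q ((suc n · δ) ^ d ℚ.≤? q)) ]′ (search n)

    q<q+1 : q < q + 1ℚ
    q<q+1 = subst (_< q + 1ℚ) (ℚ.+-identityʳ q) (ℚ.+-monoʳ-< q 0<1)

    1≤q+1 : 1ℚ ≤ q + 1ℚ
    1≤q+1 = subst (_≤ q + 1ℚ) (ℚ.+-identityˡ 1ℚ) (ℚ.+-monoˡ-≤ 1ℚ 0≤q)

    nδ^d≰q : ∀ n → q + 1ℚ ≤ n · δ → (n · δ) ^ d ≰ q
    nδ^d≰q n q+1≤nδ nδ^d≤q = ℚ.<-irrefl refl (begin-strict
      q            <⟨ q<q+1 ⟩
      q + 1ℚ       ≤⟨ q+1≤nδ ⟩
      n · δ        ≤⟨ 1≤p⇒p≤p^n d (ℚ.≤-trans 1≤q+1 q+1≤nδ) ⟩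
      (n · δ) ^ d  ≤⟨ nδ^d≤q ⟩
      q            ∎)
      where open ≤R

  approxRoot-close : ∀ d .{{_ : NonZero d}} {p q δ δ′ ε ρ σ} →
                     0ℚ < δ′ → 0ℚ < ε → δ′ < ½ * ε → p < q + (½ * ε) ^ d →
                     ApproxRoot d p δ ρ → ApproxRoot d q δ′ σ → ρ < σ + ε
  approxRoot-close d {p} {q} {δ} {δ′} {ε} {ρ} {σ} 0<δ′ 0<ε δ′< p<
                   (0≤ρ , ρ^d≤p , _) (0≤σ , _ , q<) =
    ℚ.≰⇒> λ σ+ε≤ρ → ℚ.<-irrefl refl (begin-strict
      p                              <⟨ p< ⟩
      q + (½ * ε) ^ d                <⟨ ℚ.+-monoˡ-< ((½ * ε) ^ d) q< ⟩
      (σ + δ′) ^ d + (½ * ε) ^ d     ≤⟨ ^-superadditive d 0≤σ+δ′ (ℚ.<⇒≤ 0<½ε) ⟩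
      (σ + δ′ + ½ * ε) ^ d           ≤⟨ ^-mono-≤ d (ℚ.≤-trans 0≤σ+δ′ (p≤p+q (ℚ.<⇒≤ 0<½ε))) (σ+δ′+½ε≤ρ σ+ε≤ρ) ⟩
      ρ ^ d                          ≤⟨ ρ^d≤p ⟩
      p                              ∎)
    where
    open ≤R
    0<½ε : 0ℚ < ½ * ε
    0<½ε = half-pos 0<ε

    0≤σ+δ′ : 0ℚ ≤ σ + δ′
    0≤σ+δ′ = ℚ.≤-trans 0≤σ (p≤p+q (ℚ.<⇒≤ 0<δ′))

    σ+δ′+½ε≤ρ : σ + ε ≤ ρ → σ + δ′ + ½ * ε ≤ ρ
    σ+δ′+½ε≤ρ σ+ε≤ρ = begin
      σ + δ′ + ½ * ε       ≤⟨ ℚ.+-monoˡ-≤ (½ * ε) (ℚ.+-monoʳ-≤ σ (ℚ.<⇒≤ δ′<)) ⟩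
      σ + ½ * ε + ½ * ε    ≡⟨ ℚ.+-assoc σ (½ * ε) (½ * ε) ⟩
      σ + (½ * ε + ½ * ε)  ≡⟨ cong (λ p → σ + p) (half+half ε) ⟩
      σ + ε                ≤⟨ σ+ε≤ρ ⟩
      ρ                    ∎

-- Cauchy sequences of rationals, with an explicit modulus.
record ℝ : Set where
  constructor mkℝ
  field
    seq    : ℕ → ℚ
    cauchy : ∀ ε → 0ℚ ℚ.< ε →
             ∃[ K ] (∀ k l → K ℕ.≤ k → K ℕ.≤ l → ℚ.∣ seq k ℚ.- seq l ∣ ℚ.< ε)

open ℝ public

infix 4 _≤_ _<_

_≤_ : ℝ → ℝ → Set
x ≤ y = ∀ ε → 0ℚ ℚ.< ε → ∃[ K ] (∀ k → K ℕ.≤ k → seq x k ℚ.≤ seq y k ℚ.+ ε)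

_<_ : ℝ → ℝ → Set
x < y = ∃[ ε ] (0ℚ ℚ.< ε × ∃[ K ] (∀ k → K ℕ.≤ k → seq x k ℚ.+ ε ℚ.≤ seq y k))

infixl 6 _+_ _-_ _⊔_
infixl 7 _*_
infix  8 -_

fromℚ : ℚ → ℝ
fromℚ q = mkℝ (λ _ → q) λ ε 0<ε →
  0 , λ _ _ _ _ → subst (λ p → ℚ.∣ p ∣ ℚ.< ε) (sym (ℚ.+-inverseʳ q)) 0<ε

0ℝ 1ℝ : ℝ
0ℝ = fromℚ 0ℚ
1ℝ = fromℚ 1ℚ

-_ : ℝ → ℝ
- x = mkℝ (λ k → ℚ.- seq x k) λ ε 0<ε →
  let K , close = cauchy x ε 0<ε in
  K , λ k l K≤k K≤l → subst (ℚ._< ε) (eq (seq x k) (seq x l)) (close k l K≤k K≤l)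
  where
  eq : ∀ p q → ℚ.∣ p ℚ.- q ∣ ≡ ℚ.∣ ℚ.- p ℚ.- ℚ.- q ∣
  eq p q = trans (sym (ℚ.∣-p∣≡∣p∣ (p ℚ.- q))) (cong ℚ.∣_∣ (ℚ.neg-distrib-+ p (ℚ.- q)))

_+_ : ℝ → ℝ → ℝ
x + y = mkℝ (λ k → seq x k ℚ.+ seq y k) λ ε 0<ε →
  let K , close-x = cauchy x (½ ℚ.* ε) (half-pos 0<ε)
      L , close-y = cauchy y (½ ℚ.* ε) (half-pos 0<ε)
  in K ℕ.⊔ L , λ k l ≤k ≤l →
  +-near (seq x k) (seq y k) (seq x l) (seq y l)
    (close-x k l (ℕ.m⊔n≤o⇒m≤o K L ≤k) (ℕ.m⊔n≤o⇒m≤o K L ≤l))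
    (close-y k l (ℕ.m⊔n≤o⇒n≤o K L ≤k) (ℕ.m⊔n≤o⇒n≤o K L ≤l))
  where open RationalLemmas

_-_ : ℝ → ℝ → ℝ
x - y = x + - y

eventuallyBounded : ∀ x → ∃[ M ] (0ℚ ℚ.< M × ∃[ K ] (∀ k → K ℕ.≤ k → ℚ.∣ seq x k ∣ ℚ.≤ M))
eventuallyBounded x =
  let K , close = cauchy x 1ℚ 0<1
      b = seq x K
  in ℚ.∣ b ∣ ℚ.+ 1ℚ , ℚ.+-mono-≤-< (ℚ.0≤∣p∣ b) 0<1 , K , λ k K≤k →
  let a = seq x k in begin
    ℚ.∣ a ∣                    ≡⟨ cong ℚ.∣_∣ (solve 2 (λ a b → a := b :+ (a :- b)) refl a b) ⟩
    ℚ.∣ b ℚ.+ (a ℚ.- b) ∣      ≤⟨ ℚ.∣p+q∣≤∣p∣+∣q∣ b (a ℚ.- b) ⟩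
    ℚ.∣ b ∣ ℚ.+ ℚ.∣ a ℚ.- b ∣  ≤⟨ ℚ.+-monoʳ-≤ ℚ.∣ b ∣ (ℚ.<⇒≤ (close k K K≤k ℕ.≤-refl)) ⟩
    ℚ.∣ b ∣ ℚ.+ 1ℚ             ∎
  where
  open RationalLemmas using (0<1)
  open ℚ.≤-Reasoning
  open import Data.Rational.Solver using (module +-*-Solver)
  open +-*-Solver using (solve; _:=_; _:+_; _:-_)

_*_ : ℝ → ℝ → ℝ
x * y = mkℝ (λ k → seq x k ℚ.* seq y k) λ ε 0<ε →
  let A , 0<A , K₁ , x-bound = eventuallyBounded x
      B , 0<B , K₂ , y-bound = eventuallyBounded y
      α , 0<α , Bα≡½ε = scale 0<B (half-pos 0<ε)
      β , 0<β , Aβ≡½ε = scale 0<A (half-pos 0<ε)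
      K₃ , close-x = cauchy x α 0<α
      K₄ , close-y = cauchy y β 0<β
      K₁₂ = K₁ ℕ.⊔ K₂
      K₃₄ = K₃ ℕ.⊔ K₄
  in K₁₂ ℕ.⊔ K₃₄ , λ k l ≤k ≤l →
  let ≤k₁₂ = ℕ.m⊔n≤o⇒m≤o K₁₂ K₃₄ ≤k
      ≤k₃₄ = ℕ.m⊔n≤o⇒n≤o K₁₂ K₃₄ ≤k
      ≤l₁₂ = ℕ.m⊔n≤o⇒m≤o K₁₂ K₃₄ ≤l
      ≤l₃₄ = ℕ.m⊔n≤o⇒n≤o K₁₂ K₃₄ ≤l
  in *-near (seq x k) (seq y k) (seq x l) (seq y l) 0<A 0<B Aβ≡½ε Bα≡½ε
    (x-bound k (ℕ.m⊔n≤o⇒m≤o K₁ K₂ ≤k₁₂))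
    (y-bound l (ℕ.m⊔n≤o⇒n≤o K₁ K₂ ≤l₁₂))
    (close-x k l (ℕ.m⊔n≤o⇒m≤o K₃ K₄ ≤k₃₄) (ℕ.m⊔n≤o⇒m≤o K₃ K₄ ≤l₃₄))
    (close-y k l (ℕ.m⊔n≤o⇒n≤o K₃ K₄ ≤k₃₄) (ℕ.m⊔n≤o⇒n≤o K₃ K₄ ≤l₃₄))
  where open RationalLemmas

_⊔_ : ℝ → ℝ → ℝ
x ⊔ y = mkℝ (λ k → seq x k ℚ.⊔ seq y k) λ ε 0<ε →
  let K , close-x = cauchy x ε 0<ε
      L , close-y = cauchy y ε 0<ε
  in K ℕ.⊔ L , λ k l ≤k ≤l →
  ⊔-near (seq x k) (seq y k) (seq x l) (seq y l)
    (close-x k l (ℕ.m⊔n≤o⇒m≤o K L ≤k) (ℕ.m⊔n≤o⇒m≤o K L ≤l))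
    (close-y k l (ℕ.m⊔n≤o⇒n≤o K L ≤k) (ℕ.m⊔n≤o⇒n≤o K L ≤l))
  where open RationalLemmas

-- The d-th root of x ⊔ 0: its k-th term ρ is a rational with ρ ≥ 0 and
-- ρ ^ d ≤ q < (ρ + 1/(k+1)) ^ d, where q is the k-th term of x ⊔ 0.
root : ∀ d .{{_ : NonZero d}} → ℝ → ℝ
root d x = mkℝ (λ k → proj₁ (approx k)) λ ε 0<ε →
  let 0<½ε = half-pos 0<ε
      K , close = cauchy y ((½ ℚ.* ε) ^ d) (^-pos d 0<½ε)
      L , small = 1/suc-vanishes 0<½ε
  in K ℕ.⊔ L , λ k l ≤k ≤l →
  let near = close k l (ℕ.m⊔n≤o⇒m≤o K L ≤k) (ℕ.m⊔n≤o⇒m≤o K L ≤l)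
  in <⇒near
    (approxRoot-close d (1/suc-pos l) 0<ε (small l (ℕ.m⊔n≤o⇒n≤o K L ≤l)) (near⇒< (seq y k) (seq y l) near)
      (proj₂ (approx k)) (proj₂ (approx l)))
    (approxRoot-close d (1/suc-pos k) 0<ε (small k (ℕ.m⊔n≤o⇒n≤o K L ≤k)) (near⇒> (seq y k) (seq y l) near)
      (proj₂ (approx l)) (proj₂ (approx k)))
  where
  open RationalLemmas
  y : ℝ
  y = x ⊔ 0ℝ
  approx : ∀ k → ∃ (ApproxRoot d (seq y k) (1/suc k))
  approx k = approxRoot d (ℚ.p≤q⊔p (seq x k) 0ℚ) (1/suc-pos k)

sqrt : ℝ → ℝ
sqrt = root 2

sum : ∀ {n} → Vector ℝ n → ℝ
sum = foldr _+_ 0ℝ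

max : ∀ {n} .{{_ : NonZero n}} → Vector ℝ n → ℝ
max {suc n} v = foldr _⊔_ (head v) (tail v)

infixl 6 _-ᵛ_

_-ᵛ_ : ∀ {d} → Vector ℝ d → Vector ℝ d → Vector ℝ d
_-ᵛ_ = zipWith _-_

∥_∥₂ : ∀ {d} → Vector ℝ d → ℝ
∥ v ∥₂ = sqrt (sum (map (λ a → a * a) v))

-- The proofs of a proposition such as x ≤ y in ℝ are not unique, so the
-- cardinality of a subset is not that of the corresponding Σ-type; it is the
-- length of a duplicate-free list of the elements.  It is a relation to N and
-- not a function into ℕ because membership need not be decidable.
∣_∣≡_ : {A : Set} → (A → Set) → ℕ → Set
∣ P ∣≡ N = ∃[ xs ] (Unique xs × (∀ a → a ∈ xs ⇔ P a) × length xs ≡ N)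

NearPair : ∀ {d n} → Vector (Vector ℝ d) n → ℝ → Fin n × Fin n → Set
NearPair x δ (i , j) = i Fin.< j × ∥ x i -ᵛ x j ∥₂ ≤ δ

instance
  m+n≢0 : ∀ {m n} .{{_ : NonZero n}} → NonZero (m ℕ.+ n)
  m+n≢0 {zero}  {suc n} = _
  m+n≢0 {suc m} {n}     = _

{-# OPTIONS --safe #-}
-- Turán: the near-pair graph, having N edges, contains at least n² / (2N + n)
-- pairwise non-adjacent vertices, so it suffices to bound by (1 + 2R/δ)^d the
-- number m of points of a ball of radius R at mutual distance at least δ.
-- Instead of comparing volumes, take ρ with R + tρ = ρ and 2tρ = δ: the maps
-- z ↦ y i + t z send the ball of radius ρ to m disjoint balls inside it.
-- Iterating k times gives m^k points at scale t^k, and a grid argument shows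
-- m^k ≤ C t^(-kd) with C independent of k; hence m ≤ t^(-d) = (1 + 2R/δ)^d.
-- All of this happens over ℚ, at one late index of the Cauchy sequences.
module Submission where

open import Data.Bool.Base using (if_then_else_)
open import Data.Fin.Base as Fin using (Fin; fromℕ<; finToFun; funToFin)
import Data.Fin.Properties as Fin
import Data.Integer.Base as ℤ
import Data.Integer.Properties as ℤ
open import Data.List.Base as List using (List; []; _∷_; length; filter)
open import Data.List.Extrema.Nat using (argmin; f[argmin]≤f[xs]; f[argmin]≤f[⊤]; argmin-sel)
import Data.List.Membership.DecPropositional as DecMembership
open import Data.List.Membership.Propositional using (_∈_; _∉_)
open import Data.List.Membership.Propositional.Properties using (∈-filter⁻)
import Data.List.Properties as List
open import Data.List.Relation.Unary.All as All using (All; []; _∷_)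
open import Data.List.Relation.Unary.Any as Any using (here; there)
open import Data.List.Relation.Unary.Unique.Propositional using (Unique; []; _∷_)
open import Data.List.Relation.Unary.Unique.Propositional.Properties using (allFin⁺)
open import Data.Nat.Base as ℕ using (ℕ; zero; suc; NonZero)
open import Data.Nat.Induction using (<-wellFounded; Acc; acc)
import Data.Nat.ListAction as ℕ
import Data.Nat.Properties as ℕ
open import Data.Product using (∃-syntax; Σ-syntax; _×_; _,_; proj₁; proj₂)
open import Data.Product.Properties using (≡-dec)
open import Data.Rational.Base as ℚ using (ℚ; 0ℚ; 1ℚ; ½)
import Data.Rational.Properties as ℚ
import Data.Rational.Unnormalised.Base as ℚᵘ
import Data.Rational.Unnormalised.Properties as ℚᵘ
open import Data.Sum.Base using (inj₁; inj₂)
open import Data.Vec.Functional using (Vector; foldr; map) renaming ([] to []ᵛ; _∷_ to _∷ᵛ_)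
open import Defs using (module RationalLemmas)
open import Function.Base using (_∘_)
open import Function.Bundles using (_⇔_; Equivalence)
open import Relation.Binary.Definitions using (DecidableEquality; Tri; tri<; tri≈; tri>)
open import Relation.Binary.PropositionalEquality hiding (J)
open import Relation.Nullary using (¬_; Dec; yes; no; contradiction)
open import Relation.Nullary.Decidable using (¬?; does; dec-true; dec-false)
open import Relation.Unary using (Decidable)

-- A single count of grid cells bounds m only up to a factor depending on d. Iteration removes it: m
-- t^d is raised to the k-th power while the factor stays fixed, so the sharp constant of the volume
-- argument comes out of pure counting. For this the images of the ball must keep a positive
-- distance s, not merely be disjoint; the ε in the definition of `_≤_` pays for that slack.
-- `NearPair` need not be decidable, but membership in the list of near pairs is, so the graph is
-- read off the list. A pair outside the list is then known to be far only up to a prescribed error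
-- and from some index on, which is why every separation below carries an error term. Each vertex
-- counts as its own neighbour. The total degree is thus at most 2N + n, and the greedy bound
-- becomes exactly n² / (2N + n).

-- Turán's bound for graphs with weights in ℕ.

module Turán where

  open import Data.Nat.Base
  open import Data.Nat.Solver using (module +-*-Solver)
  open +-*-Solver using (solve; _:=_; _:+_; _:*_; con)

  m²≤n²⇒m≤n : ∀ {m n} → m * m ≤ n * n → m ≤ n
  m²≤n²⇒m≤n m²≤n² = ℕ.≮⇒≥ λ n<m → ℕ.<⇒≱ (ℕ.*-mono-< n<m n<m) m²≤n²

  4mn≤[m+n]²′ : ∀ {m n} → m ≤ n → 4 * (m * n) ≤ (m + n) * (m + n)
  4mn≤[m+n]²′ {m} m≤n with k , refl ← ℕ.m≤n⇒∃[o]m+o≡n m≤n =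
    subst (4 * (m * (m + k)) ≤_)
      (solve 2 (λ m k → con 4 :* (m :* (m :+ k)) :+ k :* k
                        := (m :+ (m :+ k)) :* (m :+ (m :+ k))) refl m k)
      (ℕ.m≤m+n _ (k * k))

  4mn≤[m+n]² : ∀ m n → 4 * (m * n) ≤ (m + n) * (m + n)
  4mn≤[m+n]² m n with ℕ.≤-total m n
  ... | inj₁ m≤n = 4mn≤[m+n]²′ m≤n
  ... | inj₂ n≤m = subst₂ _≤_ (cong (4 *_) (ℕ.*-comm n m)) (cong (λ k → k * k) (ℕ.+-comm n m))
                     (4mn≤[m+n]²′ n≤m)

  -- Cauchy–Schwarz for (c , n) against (c² , s) and (1 , m).
  [c+n]²≤[1+m][c²+s] : ∀ c n {m s} → n * n ≤ m * s →
                       (c + n) * (c + n) ≤ suc m * (c * c + s)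
  [c+n]²≤[1+m][c²+s] c n {m} {s} n²≤ms = begin
    (c + n) * (c + n)
      ≡⟨ solve 2 (λ c n → (c :+ n) :* (c :+ n) := c :* c :+ con 2 :* (c :* n) :+ n :* n) refl c n ⟩
    c * c + 2 * (c * n) + n * n
      ≤⟨ ℕ.+-mono-≤ (ℕ.+-monoʳ-≤ (c * c) cross) n²≤ms ⟩
    c * c + (c * c * m + s) + m * s
      ≡⟨ solve 3 (λ c m s → c :* c :+ (c :* c :* m :+ s) :+ m :* s
                            := (con 1 :+ m) :* (c :* c :+ s)) refl c m s ⟩
    suc m * (c * c + s)
      ∎
    where
    open ℕ.≤-Reasoning
    -- AM-GM for c²m and s, in squared form: (2cn)² ≤ 4 (c²m) s ≤ (c²m + s)².
    cross : 2 * (c * n) ≤ c * c * m + s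
    cross = m²≤n²⇒m≤n (begin
      2 * (c * n) * (2 * (c * n))
        ≡⟨ solve 2 (λ c n → con 2 :* (c :* n) :* (con 2 :* (c :* n))
                            := con 4 :* (c :* c) :* (n :* n)) refl c n ⟩
      4 * (c * c) * (n * n)
        ≤⟨ ℕ.*-monoʳ-≤ (4 * (c * c)) n²≤ms ⟩
      4 * (c * c) * (m * s)
        ≡⟨ solve 3 (λ c m s → con 4 :* (c :* c) :* (m :* s) := con 4 :* (c :* c :* m :* s)) refl c m s ⟩
      4 * (c * c * m * s)
        ≤⟨ 4mn≤[m+n]² (c * c * m) s ⟩
      (c * c * m + s) * (c * c * m + s)
        ∎)

  module _ {A : Set} where

    ∑ : List A → (A → ℕ) → ℕ
    ∑ l f = ℕ.sum (List.map f l)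

    ∑-mono : ∀ {f g} l → (∀ u → f u ≤ g u) → ∑ l f ≤ ∑ l g
    ∑-mono []      f≤g = z≤n
    ∑-mono (u ∷ l) f≤g = ℕ.+-mono-≤ (f≤g u) (∑-mono l f≤g)

    ∑-cong : ∀ {f g} l → (∀ u → f u ≡ g u) → ∑ l f ≡ ∑ l g
    ∑-cong l f≗g = cong ℕ.sum (List.map-cong f≗g l)

    ∑-+ : ∀ {f g} l → ∑ l (λ u → f u + g u) ≡ ∑ l f + ∑ l g
    ∑-+ []              = refl
    ∑-+ {f} {g} (u ∷ l) = trans (cong (f u + g u +_) (∑-+ l))
      (solve 4 (λ a b c d → a :+ b :+ (c :+ d) := a :+ c :+ (b :+ d)) refl
        (f u) (g u) (∑ l f) (∑ l g))

    ∑-* : ∀ k {f} l → ∑ l (λ u → k * f u) ≡ k * ∑ l f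
    ∑-* k     []      = sym (ℕ.*-zeroʳ k)
    ∑-* k {f} (u ∷ l) = trans (cong (k * f u +_) (∑-* k l)) (sym (ℕ.*-distribˡ-+ k (f u) (∑ l f)))

    ∑-const : ∀ l → ∑ l (λ _ → 1) ≡ length l
    ∑-const []      = refl
    ∑-const (_ ∷ l) = cong suc (∑-const l)

    module _ {P : A → Set} (P? : Decidable P) where

      length-filter+filter-¬ : ∀ l → length (filter (¬? ∘ P?) l) + length (filter P? l) ≡ length l
      length-filter+filter-¬ []      = refl
      length-filter+filter-¬ (u ∷ l) with P? u
      ... | yes _ = trans (ℕ.+-suc _ _) (cong suc (length-filter+filter-¬ l))
      ... | no  _ = cong suc (length-filter+filter-¬ l)

      -- With `D` equal to 1, 0 and the minimal degree this yields the three estimates of the greedy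
      -- step.
      ∑-filter : ∀ {D} {f g : A → ℕ} {l} → All (λ u → ¬ P u → D ≤ f u) l → (∀ u → g u ≤ f u) →
                 length (filter (¬? ∘ P?) l) * D + ∑ (filter P? l) g ≤ ∑ l f
      ∑-filter []        g≤f = z≤n
      ∑-filter {D} {f} {g} {u ∷ l} (D≤ ∷ D≤s) g≤f with P? u
      ... | yes _  = begin
        r * D + (g u + s)  ≡⟨ solve 3 (λ a b c → a :+ (b :+ c) := b :+ (a :+ c)) refl (r * D) (g u) s ⟩
        g u + (r * D + s)  ≤⟨ ℕ.+-mono-≤ (g≤f u) (∑-filter D≤s g≤f) ⟩
        f u + ∑ l f     ∎
        where
        open ℕ.≤-Reasoning
        r = length (filter (¬? ∘ P?) l)
        s = ∑ (filter P? l) g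
      ... | no ¬Pu = begin
        D + r * D + s      ≡⟨ ℕ.+-assoc D (r * D) s ⟩
        D + (r * D + s)    ≤⟨ ℕ.+-mono-≤ (D≤ ¬Pu) (∑-filter D≤s g≤f) ⟩
        f u + ∑ l f     ∎
        where
        open ℕ.≤-Reasoning
        r = length (filter (¬? ∘ P?) l)
        s = ∑ (filter P? l) g

    module _ (w : A → A → ℕ) where

      degree : List A → A → ℕ
      degree l v = ∑ l (w v)

      totalDegree : List A → ℕ
      totalDegree l = ∑ l (degree l)

      minDegree : ∀ u l → ∃[ v ] (v ∈ u ∷ l × All (λ t → degree (u ∷ l) v ≤ degree (u ∷ l) t) (u ∷ l))
      minDegree u l = v , v∈ (argmin-sel f u l) , f[argmin]≤f[⊤] {f = f} u l ∷ f[argmin]≤f[xs] {f = f} u l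
        where
        f = degree (u ∷ l)
        v = argmin f u l
        v∈ : _ → v ∈ u ∷ l
        v∈ (inj₁ v≡u) = here v≡u
        v∈ (inj₂ v∈l) = there v∈l

      -- The last component is m ≥ (length l)² / totalDegree l with the division cleared. Only i < j
      -- is recorded because `w` is not assumed symmetric and a chosen vertex constrains just the
      -- later ones.
      FarFamily : List A → Set
      FarFamily l = Σ[ m ∈ ℕ ] Σ[ f ∈ Vector A m ]
        ((∀ i → f i ∈ l) × (∀ i j → i Fin.< j → w (f i) (f j) ≡ 0)
         × length l * length l ≤ m * totalDegree l)

      -- Greedily choose a vertex of minimal degree and discard its neighbours.
      turán′ : (∀ v → 1 ≤ w v v) → ∀ l → Acc _<_ (length l) → FarFamily l
      turán′ _      []          _         = 0 , []ᵛ , (λ ()) , (λ ()) , z≤n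
      turán′ w-refl l@(u ∷ l₀) (acc rec) =
        let m , f , f∈ , f-far , bound = turán′ w-refl l′ (rec l′-shorter) in
          suc m
        , v ∷ᵛ f
        , (λ { Fin.zero → v∈l ; (Fin.suc i) → proj₁ (∈-filter⁻ far? (f∈ i)) })
        , (λ { Fin.zero (Fin.suc j) _ → proj₂ (∈-filter⁻ far? {xs = l} (f∈ j))
             ; (Fin.suc i) (Fin.suc j) (s<s i<j) → f-far i j i<j })
        , subst (λ n → n * n ≤ suc m * totalDegree l) (length-filter+filter-¬ far? l)
            (ℕ.≤-trans ([c+n]²≤[1+m][c²+s] c (length l′) {m} bound) (ℕ.*-monoʳ-≤ (suc m) total≥))
        where
        v = proj₁ (minDegree u l₀)
        v∈l = proj₁ (proj₂ (minDegree u l₀))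
        far? : Decidable (λ t → w v t ≡ 0)
        far? t = w v t ℕ.≟ 0
        l′ = filter far? l
        c = length (filter (¬? ∘ far?) l)

        l′-shorter : length l′ < length l
        l′-shorter = List.filter-notAll far? l
          (Any.map (λ { refl wvv≡0 → ℕ.<⇒≢ (w-refl v) (sym wvv≡0) }) v∈l)

        c≤degree : c ≤ degree l v
        c≤degree = begin
          c                      ≡⟨ ℕ.*-identityʳ c ⟨
          c * 1                  ≤⟨ ℕ.m≤m+n (c * 1) (∑ l′ (w v)) ⟩
          c * 1 + ∑ l′ (w v)     ≤⟨ ∑-filter far? (All.tabulate λ _ → ℕ.n≢0⇒n>0) (λ _ → ℕ.≤-refl) ⟩
          degree l v             ∎
          where open ℕ.≤-Reasoning

        degree′≤ : ∀ t → degree l′ t ≤ degree l t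
        degree′≤ t = ℕ.≤-trans (ℕ.m≤n+m _ (c * 0))
          (∑-filter far? {l = l} (All.tabulate λ _ _ → z≤n) (λ _ → ℕ.≤-refl))

        -- All c discarded vertices have degree at least that of `v`, which is at least c since each
        -- of them has positive weight from `v`. So the total degree drops by c² or more.
        total≥ : c * c + totalDegree l′ ≤ totalDegree l
        total≥ = ℕ.≤-trans (ℕ.+-monoˡ-≤ (totalDegree l′) (ℕ.*-monoʳ-≤ c c≤degree))
          (∑-filter far? (All.map (λ ≤deg _ → ≤deg) (proj₂ (proj₂ (minDegree u l₀)))) degree′≤)

      turán : (∀ v → 1 ≤ w v v) → ∀ l → FarFamily l
      turán w-refl l = turán′ w-refl l (<-wellFounded (length l))

  -- The weighted graph of a list of pairs.

  module EdgeList {A : Set} (_≟_ : DecidableEquality A) where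

    [_≐_] : A → A → ℕ
    [ u ≐ v ] = if does (u ≟ v) then 1 else 0

    [≐]-refl : ∀ u → [ u ≐ u ] ≡ 1
    [≐]-refl u rewrite dec-true (u ≟ u) refl = refl

    arc : A → A → A → A → ℕ
    arc a b v u = [ a ≐ v ] * [ b ≐ u ]

    arc-refl : ∀ a b → arc a b a b ≡ 1
    arc-refl a b = cong₂ _*_ ([≐]-refl a) ([≐]-refl b)

    -- The identity matrix plus both orientations of every listed pair. Counting with multiplicity
    -- makes the total degree additive along the list; the diagonal supplies the loops that `turán`
    -- requires and the summand n of 2N + n.
    weight : List (A × A) → A → A → ℕ
    weight []             v u = [ v ≐ u ]
    weight ((a , b) ∷ xs) v u = arc a b v u + arc b a v u + weight xs v u

    weight-refl : ∀ xs v → 1 ≤ weight xs v v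
    weight-refl []             v = ℕ.≤-reflexive (sym ([≐]-refl v))
    weight-refl ((a , b) ∷ xs) v = ℕ.≤-trans (weight-refl xs v) (ℕ.m≤n+m _ _)

    weight≡0⇒≢ : ∀ xs {v u} → weight xs v u ≡ 0 → v ≢ u
    weight≡0⇒≢ xs {v} w≡0 refl = ℕ.<⇒≢ (weight-refl xs v) (sym w≡0)

    weight≡0⇒∉ : ∀ xs {v u} → weight xs v u ≡ 0 → (v , u) ∉ xs
    weight≡0⇒∉ ((a , b) ∷ xs) w≡0 (here refl) = ℕ.1+n≢0 {0}
      (trans (sym (arc-refl a b)) (ℕ.m+n≡0⇒m≡0 _ (ℕ.m+n≡0⇒m≡0 _ w≡0)))
    weight≡0⇒∉ ((a , b) ∷ xs) {v} {u} w≡0 (there vu∈xs) =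
      weight≡0⇒∉ xs (ℕ.m+n≡0⇒n≡0 (arc a b v u + arc b a v u) w≡0) vu∈xs

    weight≡0⇒swap∉ : ∀ xs {v u} → weight xs v u ≡ 0 → (u , v) ∉ xs
    weight≡0⇒swap∉ ((a , b) ∷ xs) w≡0 (here refl) = ℕ.1+n≢0 {0}
      (trans (sym (arc-refl b a)) (ℕ.m+n≡0⇒n≡0 (arc a b b a) (ℕ.m+n≡0⇒m≡0 _ w≡0)))
    weight≡0⇒swap∉ ((a , b) ∷ xs) {v} {u} w≡0 (there uv∈xs) =
      weight≡0⇒swap∉ xs (ℕ.m+n≡0⇒n≡0 (arc a b v u + arc b a v u) w≡0) uv∈xs

    ∑[≐]≤1 : ∀ {l} → Unique l → ∀ u → ∑ l [ u ≐_] ≤ 1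
    ∑[≐]≤1 []                _ = z≤n
    ∑[≐]≤1 {v ∷ l} (v∉l ∷ l!) u with u ≟ v
    ... | no  _    = ∑[≐]≤1 l! u
    ... | yes refl = s≤s (ℕ.≤-reflexive (absent v∉l))
      where
      absent : ∀ {l} → All (u ≢_) l → ∑ l [ u ≐_] ≡ 0
      absent []          = refl
      absent {t ∷ _} (u≢t ∷ u∉) rewrite dec-false (u ≟ t) u≢t = absent u∉

    -- Summed over all pairs of vertices, an arc gives a product of two sums of indicators, each at
    -- most 1 because `l` has no repetitions. Hence every listed pair adds at most 2.
    totalDegree-weight : ∀ {l} → Unique l → ∀ xs →
                         totalDegree (weight xs) l ≤ 2 * length xs + length l
    totalDegree-weight {l} l! []  =
      ℕ.≤-trans (∑-mono l (∑[≐]≤1 l!)) (ℕ.≤-reflexive (∑-const l))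
    totalDegree-weight {l} l! ((a , b) ∷ xs) = begin
      ∑ l (λ v → ∑ l (λ u → arc a b v u + arc b a v u + weight xs v u))
        ≡⟨ ∑-cong l (λ v → trans (∑-+ l) (cong (_+ ∑ l (weight xs v)) (∑-+ l))) ⟩
      ∑ l (λ v → ∑ l (arc a b v) + ∑ l (arc b a v) + ∑ l (weight xs v))
        ≡⟨ trans (∑-+ l) (cong (_+ totalDegree (weight xs) l) (∑-+ l)) ⟩
      ∑ l (λ v → ∑ l (arc a b v)) + ∑ l (λ v → ∑ l (arc b a v)) + totalDegree (weight xs) l
        ≤⟨ ℕ.+-mono-≤ (ℕ.+-mono-≤ (arcs a b) (arcs b a)) (totalDegree-weight l! xs) ⟩
      2 + (2 * length xs + length l)
        ≡⟨ cong (_+ length l) (ℕ.*-distribˡ-+ 2 1 (length xs)) ⟨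
      2 * suc (length xs) + length l
        ∎
      where
      open ℕ.≤-Reasoning
      arcs : ∀ a b → ∑ l (λ v → ∑ l (arc a b v)) ≤ 1
      arcs a b = begin
        ∑ l (λ v → ∑ l (arc a b v))           ≡⟨ ∑-cong l (λ v → ∑-* [ a ≐ v ] l) ⟩
        ∑ l (λ v → [ a ≐ v ] * ∑ l [ b ≐_])   ≤⟨ ∑-mono l (λ v → ℕ.*-monoʳ-≤ [ a ≐ v ] (∑[≐]≤1 l! b)) ⟩
        ∑ l (λ v → [ a ≐ v ] * 1)             ≡⟨ ∑-cong l (λ v → ℕ.*-identityʳ [ a ≐ v ]) ⟩
        ∑ l [ a ≐_]                           ≤⟨ ∑[≐]≤1 l! a ⟩
        1                                     ∎

-- Ordered arithmetic of ℚ.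

module Packing where

  open import Algebra.Bundles using (CommutativeRing)
  open import Algebra.Definitions.RawMonoid ℚ.+-0-rawMonoid using (sum) renaming (_×_ to _·_)
  open import Algebra.Properties.CommutativeSemiring.Exp (CommutativeRing.commutativeSemiring ℚ.+-*-commutativeRing)
    using (^-distrib-*)
  open import Algebra.Properties.Semiring.Exp (CommutativeRing.semiring ℚ.+-*-commutativeRing)
    using (^-assocʳ)
  open import Algebra.Properties.Semiring.Mult (CommutativeRing.semiring ℚ.+-*-commutativeRing)
    using (×-homo-+; ×1-homo-*; ×-assoc-*)
  open import Data.Rational.Base hiding (NonZero; floor)
  open import Data.Rational.Solver using (module +-*-Solver)
  open +-*-Solver using (solve; _:=_; _:+_; _:*_; _:-_; :-_; con)
  open RationalLemmas

  *-monoˡ-≤ : ∀ {r p q} → 0ℚ ≤ r → p ≤ q → r * p ≤ r * q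
  *-monoˡ-≤ {r} 0≤r = ℚ.*-monoˡ-≤-nonNeg r {{nonNegative 0≤r}}

  *-monoʳ-≤ : ∀ {r p q} → 0ℚ ≤ r → p ≤ q → p * r ≤ q * r
  *-monoʳ-≤ {r} 0≤r = ℚ.*-monoʳ-≤-nonNeg r {{nonNegative 0≤r}}

  *-cancelˡ-≤ : ∀ {r p q} → 0ℚ < r → r * p ≤ r * q → p ≤ q
  *-cancelˡ-≤ {r} 0<r = ℚ.*-cancelˡ-≤-pos r {{positive 0<r}}

  +-pos : ∀ {p q} → 0ℚ < p → 0ℚ < q → 0ℚ < p + q
  +-pos = ℚ.+-mono-<

  p≤q⇒0≤q-p : ∀ {p q} → p ≤ q → 0ℚ ≤ q - p
  p≤q⇒0≤q-p {p} {q} p≤q = subst (_≤ q - p) (ℚ.+-inverseʳ p) (ℚ.+-monoˡ-≤ (- p) p≤q)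

  0≤p² : ∀ p → 0ℚ ≤ p * p
  0≤p² p with ℚ.≤-total 0ℚ p
  ... | inj₁ 0≤p = *-nonNeg 0≤p 0≤p
  ... | inj₂ p≤0 = subst (0ℚ ≤_) (solve 1 (λ p → (:- p) :* (:- p) := p :* p) refl p)
                     (*-nonNeg (ℚ.neg-antimono-≤ p≤0) (ℚ.neg-antimono-≤ p≤0))

  p²≤q²⇒p≤q : ∀ {p q} → 0ℚ ≤ q → p * p ≤ q * q → p ≤ q
  p²≤q²⇒p≤q {p} {q} 0≤q p²≤q² = ℚ.≮⇒≥ λ q<p → ℚ.<-irrefl refl (begin-strict
    q * q  ≤⟨ *-monoˡ-≤ 0≤q (ℚ.<⇒≤ q<p) ⟩
    q * p  <⟨ ℚ.*-monoˡ-<-pos p {{positive (ℚ.≤-<-trans 0≤q q<p)}} q<p ⟩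
    p * p  ≤⟨ p²≤q² ⟩
    q * q  ∎)
    where open ≤R

  0≤· : ∀ n {h} → 0ℚ ≤ h → 0ℚ ≤ n · h
  0≤· zero    0≤h = ℚ.≤-refl
  0≤· (suc n) 0≤h = ℚ.+-mono-≤ 0≤h (0≤· n 0≤h)

  ·-monoˡ-≤ : ∀ {m n h} → 0ℚ ≤ h → m ℕ.≤ n → m · h ≤ n · h
  ·-monoˡ-≤ {m} {n} {h} 0≤h m≤n with k , refl ← ℕ.m≤n⇒∃[o]m+o≡n m≤n =
    subst (m · h ≤_) (sym (×-homo-+ h m k)) (p≤p+q (0≤· k 0≤h))

  floor : ∀ {h q} → 0ℚ < h → 0ℚ ≤ q → ∃[ n ] (n · h ≤ q × q < suc n · h)
  floor {h} {q} 0<h 0≤q = let n , q≤nh = archimedean q 0<h in search n q≤nh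
    where
    search : ∀ n → q ≤ n · h → ∃[ n ] (n · h ≤ q × q < suc n · h)
    search zero    q≤0  = 0 , 0≤q , ℚ.≤-<-trans q≤0 (subst (0ℚ <_) (sym (ℚ.+-identityʳ h)) 0<h)
    search (suc n) q≤sn with n · h ℚ.≤? q
    ... | no  nh≰q = search n (ℚ.<⇒≤ (ℚ.≰⇒> nh≰q))
    ... | yes nh≤q with q ℚ.<? suc n · h
    ...   | yes q<sn = n , nh≤q , q<sn
    ...   | no  q≮sn = suc n , ℚ.≮⇒≥ q≮sn , ℚ.≤-<-trans q≤sn
      (subst (_< h + suc n · h) (ℚ.+-identityˡ (suc n · h)) (ℚ.+-monoˡ-< (suc n · h) 0<h))

  -- Bernoulli's inequality; each step of the induction loses p · (n p).
  1+n·p≤[1+p]^n : ∀ n {p} → 0ℚ ≤ p → 1ℚ + n · p ≤ (1ℚ + p) ^ n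
  1+n·p≤[1+p]^n zero    0≤p = ℚ.≤-refl
  1+n·p≤[1+p]^n (suc n) {p} 0≤p = begin
    1ℚ + (p + n · p)                 ≤⟨ p≤p+q (*-nonNeg 0≤p (0≤· n 0≤p)) ⟩
    1ℚ + (p + n · p) + p * (n · p)   ≡⟨ solve 2 (λ p t → con 1ℚ :+ (p :+ t) :+ p :* t
                                                 := (con 1ℚ :+ p) :* (con 1ℚ :+ t)) refl p (n · p) ⟩
    (1ℚ + p) * (1ℚ + n · p)          ≤⟨ *-monoˡ-≤ (ℚ.+-mono-≤ (ℚ.<⇒≤ 0<1) 0≤p) (1+n·p≤[1+p]^n n 0≤p) ⟩
    (1ℚ + p) * (1ℚ + p) ^ n          ∎
    where open ≤R

  -- For p = 1 + e with e > 0, Bernoulli gives p^n b ≥ b + n e b, which exceeds `C` as soon as n e b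
  -- ≥ C. This is where the grid constant disappears.
  bounded-powers⇒≤1 : ∀ {p b C} → 0ℚ < b → (∀ k → p ^ k * b ≤ C) → p ≤ 1ℚ
  bounded-powers⇒≤1 {p} {b} {C} 0<b bounded = ℚ.≮⇒≥ λ 1<p →
    let e = p - 1ℚ
        0<e = subst (_< e) (ℚ.+-inverseʳ 1ℚ) (ℚ.+-monoˡ-< (- 1ℚ) 1<p)
        n , C≤n·eb = archimedean C (*-pos 0<e 0<b)
    in ℚ.<-irrefl refl (begin-strict
      C                     ≤⟨ C≤n·eb ⟩
      n · (e * b)           <⟨ subst (_< b + n · (e * b)) (ℚ.+-identityˡ (n · (e * b)))
                                 (ℚ.+-monoˡ-< (n · (e * b)) 0<b) ⟩
      b + n · (e * b)       ≡⟨ cong (b +_) (×-assoc-* n e b) ⟨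
      b + n · e * b         ≡⟨ solve 2 (λ b t → b :+ t :* b := (con 1ℚ :+ t) :* b) refl b (n · e) ⟩
      (1ℚ + n · e) * b      ≤⟨ *-monoʳ-≤ (ℚ.<⇒≤ 0<b) (1+n·p≤[1+p]^n n (ℚ.<⇒≤ 0<e)) ⟩
      (1ℚ + e) ^ n * b      ≡⟨ cong (λ x → x ^ n * b) (solve 1 (λ p → con 1ℚ :+ (p :- con 1ℚ) := p) refl p) ⟩
      p ^ n * b             ≤⟨ bounded n ⟩
      C                     ∎)
    where open ≤R

  infix 8 ι_
  ι_ : ℕ → ℚ
  ι n = n · 1ℚ

  ·≡ι* : ∀ n p → n · p ≡ ι n * p
  ·≡ι* n p = sym (trans (×-assoc-* n 1ℚ p) (cong (n ·_) (ℚ.*-identityˡ p)))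

  ι-^ : ∀ m k → ι (m ℕ.^ k) ≡ (ι m) ^ k
  ι-^ m zero    = refl
  ι-^ m (suc k) = trans (×1-homo-* m (m ℕ.^ k)) (cong (ι m *_) (ι-^ m k))

  0<ι : ∀ n .{{_ : NonZero n}} → 0ℚ < ι n
  0<ι n = ℚ.<-≤-trans 0<1 (·-monoˡ-≤ {1} {n} (ℚ.<⇒≤ 0<1) (ℕ.>-nonZero⁻¹ n))

  -- Euclidean balls over ℚ.

  ∣_∣² : ∀ {d} → Vector ℚ d → ℚ
  ∣ v ∣² = sum (λ c → v c * v c)

  -- Comparing squares keeps square roots out of ℚ. A negative `a` acts as the radius -a, hence the
  -- sign conditions in what follows.
  record Ball {d} (a : ℚ) (v : Vector ℚ d) : Set where
    constructor ball
    field
      ∣∣²≤ : ∣ v ∣² ≤ a * a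

  ∣∣²-cong : ∀ {d} {v w : Vector ℚ d} → (∀ c → v c ≡ w c) → ∣ v ∣² ≡ ∣ w ∣²
  ∣∣²-cong {zero}  v≗w = refl
  ∣∣²-cong {suc d} v≗w = cong₂ _+_ (cong₂ _*_ (v≗w Fin.zero) (v≗w Fin.zero)) (∣∣²-cong (v≗w ∘ Fin.suc))

  ∣∣²-scale : ∀ {d} t (v : Vector ℚ d) → ∣ (λ c → t * v c) ∣² ≡ t * t * ∣ v ∣²
  ∣∣²-scale {zero}  t v = sym (ℚ.*-zeroʳ (t * t))
  ∣∣²-scale {suc d} t v = trans (cong (t * x * (t * x) +_) (∣∣²-scale t (v ∘ Fin.suc)))
    (solve 3 (λ t x s → t :* x :* (t :* x) :+ t :* t :* s := t :* t :* (x :* x :+ s))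
      refl t x ∣ v ∘ Fin.suc ∣²)
    where x = v Fin.zero

  0≤∣∣² : ∀ {d} (v : Vector ℚ d) → 0ℚ ≤ ∣ v ∣²
  0≤∣∣² {zero}  v = ℚ.≤-refl
  0≤∣∣² {suc d} v = ℚ.+-mono-≤ (0≤p² (v Fin.zero)) (0≤∣∣² (v ∘ Fin.suc))

  coord²≤∣∣² : ∀ {d} (v : Vector ℚ d) c → v c * v c ≤ ∣ v ∣²
  coord²≤∣∣² v Fin.zero    = p≤p+q (0≤∣∣² (v ∘ Fin.suc))
  coord²≤∣∣² v (Fin.suc c) = subst (v (Fin.suc c) * v (Fin.suc c) ≤_)
    (ℚ.+-comm ∣ v ∘ Fin.suc ∣² (v Fin.zero * v Fin.zero))
    (ℚ.≤-trans (coord²≤∣∣² (v ∘ Fin.suc) c) (p≤p+q (0≤p² (v Fin.zero))))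

  -- Convexity of the square; coordinatewise the defect is (b v − a w)².
  ∣∣²-convex : ∀ {d} a b (v w : Vector ℚ d) →
               a * b * ∣ (λ c → v c + w c) ∣² ≤ (a + b) * (b * ∣ v ∣² + a * ∣ w ∣²)
  ∣∣²-convex {zero}  a b v w = ℚ.≤-reflexive
    (solve 2 (λ a b → a :* b :* con 0ℚ := (a :+ b) :* (b :* con 0ℚ :+ a :* con 0ℚ)) refl a b)
  ∣∣²-convex {suc d} a b v w = begin
    a * b * ((x + y) * (x + y) + S)
      ≡⟨ ℚ.*-distribˡ-+ (a * b) ((x + y) * (x + y)) S ⟩
    a * b * ((x + y) * (x + y)) + a * b * S
      ≤⟨ ℚ.+-mono-≤ (p≤p+q {a * b * ((x + y) * (x + y))} (0≤p² (b * x - a * y))) (∣∣²-convex a b (v ∘ Fin.suc) (w ∘ Fin.suc)) ⟩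
    a * b * ((x + y) * (x + y)) + (b * x - a * y) * (b * x - a * y) + (a + b) * (b * V + a * W)
      ≡⟨ solve 6 (λ a b x y V W →
           a :* b :* ((x :+ y) :* (x :+ y)) :+ (b :* x :- a :* y) :* (b :* x :- a :* y)
             :+ (a :+ b) :* (b :* V :+ a :* W)
           := (a :+ b) :* (b :* (x :* x :+ V) :+ a :* (y :* y :+ W))) refl a b x y V W ⟩
    (a + b) * (b * (x * x + V) + a * (y * y + W))
      ∎
    where
    open ≤R
    x = v Fin.zero
    y = w Fin.zero
    V = ∣ v ∘ Fin.suc ∣²
    W = ∣ w ∘ Fin.suc ∣²
    S = ∣ (λ c → v (Fin.suc c) + w (Fin.suc c)) ∣²

  Ball-mono : ∀ {d a b} {v : Vector ℚ d} → 0ℚ ≤ a → a ≤ b → Ball a v → Ball b v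
  Ball-mono 0≤a a≤b (ball ≤a²) = ball (ℚ.≤-trans ≤a² (*-mono-≤ (ℚ.≤-trans 0≤a a≤b) 0≤a a≤b a≤b))

  Ball-cong : ∀ {d a} {v w : Vector ℚ d} → (∀ c → v c ≡ w c) → Ball a v → Ball a w
  Ball-cong {a = a} v≗w (ball ≤a²) = ball (subst (_≤ a * a) (∣∣²-cong v≗w) ≤a²)

  -- The triangle inequality without square roots: in `∣∣²-convex`, weights equal to the two radii
  -- turn the right side into a b (a + b)².
  Ball-+ : ∀ {d a b} {v w : Vector ℚ d} → 0ℚ < a → 0ℚ < b → Ball a v → Ball b w →
           Ball (a + b) (λ c → v c + w c)
  Ball-+ {_} {a} {b} {v} {w} 0<a 0<b (ball ≤a²) (ball ≤b²) = ball (*-cancelˡ-≤ (*-pos 0<a 0<b) (begin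
    a * b * ∣ (λ c → v c + w c) ∣²
      ≤⟨ ∣∣²-convex a b v w ⟩
    (a + b) * (b * ∣ v ∣² + a * ∣ w ∣²)
      ≤⟨ *-monoˡ-≤ (ℚ.<⇒≤ (+-pos 0<a 0<b))
           (ℚ.+-mono-≤ (*-monoˡ-≤ (ℚ.<⇒≤ 0<b) ≤a²) (*-monoˡ-≤ (ℚ.<⇒≤ 0<a) ≤b²)) ⟩
    (a + b) * (b * (a * a) + a * (b * b))
      ≡⟨ solve 2 (λ a b → (a :+ b) :* (b :* (a :* a) :+ a :* (b :* b))
                          := a :* b :* ((a :+ b) :* (a :+ b))) refl a b ⟩
    a * b * ((a + b) * (a + b))
      ∎))
    where open ≤R

  scale-square : ∀ t a → t * a * (t * a) ≡ t * t * (a * a)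
  scale-square = solve 2 (λ t a → t :* a :* (t :* a) := t :* t :* (a :* a)) refl

  Ball-scale : ∀ {d a} t {v : Vector ℚ d} → Ball a v → Ball (t * a) (λ c → t * v c)
  Ball-scale {a = a} t {v} (ball ≤a²) = ball (subst₂ _≤_ (sym (∣∣²-scale t v)) (sym (scale-square t a))
    (*-monoˡ-≤ (0≤p² t) ≤a²))

  Ball-unscale : ∀ {d a t} {v : Vector ℚ d} → 0ℚ < t → Ball (t * a) (λ c → t * v c) → Ball a v
  Ball-unscale {a = a} {t} {v} 0<t (ball ≤t²a²) = ball (*-cancelˡ-≤ (*-pos 0<t 0<t)
    (subst₂ _≤_ (∣∣²-scale t v) (scale-square t a) ≤t²a²))

  Ball-neg : ∀ {d a} {v : Vector ℚ d} → Ball a v → Ball a (λ c → - v c)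
  Ball-neg {a = a} {v} (ball ≤a²) = ball (subst (_≤ a * a) (sym (trans
    (∣∣²-cong {v = λ c → - v c} (λ c → solve 1 (λ x → :- x := (:- con 1ℚ) :* x) refl (v c)))
    (trans (∣∣²-scale (- 1ℚ) v) (ℚ.*-identityˡ ∣ v ∣²)))) ≤a²)

  Ball⇒coord≤ : ∀ {d a} {v : Vector ℚ d} → 0ℚ ≤ a → Ball a v → ∀ c → v c ≤ a
  Ball⇒coord≤ {v = v} 0≤a (ball ≤a²) c = p²≤q²⇒p≤q 0≤a (ℚ.≤-trans (coord²≤∣∣² v c) ≤a²)

  -- The sharp radius √d · h may be irrational; d · h suffices, since the loss only enters the
  -- constant `C`.
  cube⇒Ball : ∀ {d h} {v : Vector ℚ d} → 0ℚ ≤ h → (∀ c → v c * v c ≤ h * h) → Ball (d · h) v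
  cube⇒Ball {zero}      0≤h v∈cube = ball ℚ.≤-refl
  cube⇒Ball {suc d} {h} {v} 0≤h v∈cube = ball (begin
    v Fin.zero * v Fin.zero + ∣ v ∘ Fin.suc ∣²
      ≤⟨ ℚ.+-mono-≤ (v∈cube Fin.zero) (Ball.∣∣²≤ (cube⇒Ball {v = v ∘ Fin.suc} 0≤h (v∈cube ∘ Fin.suc))) ⟩
    h * h + d · h * (d · h)
      ≤⟨ p≤p+q (*-nonNeg (*-nonNeg 0≤h (0≤· d 0≤h)) (ℚ.<⇒≤ (+-pos 0<1 0<1))) ⟩
    h * h + d · h * (d · h) + h * (d · h) * (1ℚ + 1ℚ)
      ≡⟨ solve 2 (λ h t → h :* h :+ t :* t :+ h :* t :* (con 1ℚ :+ con 1ℚ)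
                          := (h :+ t) :* (h :+ t)) refl h (d · h) ⟩
    (h + d · h) * (h + d · h)
      ∎)
    where
    open ≤R

  -- h² - (p - q)² factors as (h - (p - q)) (h - (q - p)), and both factors are nonnegative when p
  -- and q lie in one cell.
  cells-close : ∀ {n h p q} → n · h ≤ p → p < suc n · h → n · h ≤ q → q < suc n · h →
                (p - q) * (p - q) ≤ h * h
  cells-close {n} {h} {p} {q} n≤p p<n n≤q q<n =
    ℚ.≤-trans (p≤p+q (*-nonNeg (side p<n n≤q) (side q<n n≤p)))
      (ℚ.≤-reflexive (solve 3 (λ h p q → (p :- q) :* (p :- q) :+ (h :- (p :- q)) :* (h :- (q :- p))
                                        := h :* h) refl h p q))
    where
    open ≤R
    side : ∀ {p q} → p < suc n · h → n · h ≤ q → 0ℚ ≤ h - (p - q)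
    side {p} {q} p<n n≤q = p≤q⇒0≤q-p (begin
      p - q              ≤⟨ ℚ.+-mono-≤ (ℚ.<⇒≤ p<n) (ℚ.neg-antimono-≤ n≤q) ⟩
      h + n · h - n · h  ≡⟨ solve 2 (λ h t → h :+ t :- t := h) refl h (n · h) ⟩
      h                  ∎)

  -- Iterated contractions and the grid count.

  -- `R+tρ≡ρ` is the fixed-point equation for the radius of an invariant ball. In `separated`, t (ρ
  -- + ρ) accounts for the radii of two image balls and s for the gap between them.
  module SelfSimilar {d m : ℕ} .{{_ : NonZero d}} (y : Vector (Vector ℚ d) m) {R ρ t s : ℚ}
    (0<R : 0ℚ < R) (0<ρ : 0ℚ < ρ) (0<t : 0ℚ < t) (t≤1 : t ≤ 1ℚ) (0<s : 0ℚ < s)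
    (R+tρ≡ρ : R + t * ρ ≡ ρ) (y∈R : ∀ i → Ball R (y i))
    (separated : ∀ i j → Ball (t * (ρ + ρ) + s) (λ c → y i c - y j c) → i ≡ j)
    where

    -- The word `w` lists the contractions from the outermost to the innermost; their composite is
    -- applied to the origin.
    point : ∀ k → (Fin k → Fin m) → Vector ℚ d
    point zero    w c = 0ℚ
    point (suc k) w c = y (w Fin.zero) c + t * point k (w ∘ Fin.suc) c

    point∈Ball : ∀ k w → Ball ρ (point k w)
    point∈Ball zero    w = ball (ℚ.≤-trans (ℚ.≤-reflexive (∣0∣² d)) (0≤p² ρ))
      where
      ∣0∣² : ∀ d → ∣ (λ (_ : Fin d) → 0ℚ) ∣² ≡ 0ℚ
      ∣0∣² zero    = refl
      ∣0∣² (suc d) = trans (ℚ.+-identityˡ _) (∣0∣² d)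
    point∈Ball (suc k) w = subst (λ a → Ball a (point (suc k) w)) R+tρ≡ρ
      (Ball-+ 0<R (*-pos 0<t 0<ρ) (y∈R (w Fin.zero))
        (Ball-scale t (point∈Ball k (w ∘ Fin.suc))))

    t^n≤1 : ∀ n → t ^ n ≤ 1ℚ
    t^n≤1 zero    = ℚ.≤-refl
    t^n≤1 (suc n) = *-mono-≤ (ℚ.<⇒≤ 0<1) (^-nonNeg n (ℚ.<⇒≤ 0<t)) t≤1 (t^n≤1 n)

    0<st^ : ∀ k → 0ℚ < s * t ^ k
    0<st^ k = *-pos 0<s (^-pos k 0<t)

    st^≤s : ∀ k → s * t ^ k ≤ s
    st^≤s k = subst (s * t ^ k ≤_) (ℚ.*-identityʳ s) (*-monoˡ-≤ (ℚ.<⇒≤ 0<s) (t^n≤1 k))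

    -- Different first letters put the points into image balls more than s apart, and s t^k ≤ s.
    -- Equal first letters cancel, and dividing by t leaves words one letter shorter.
    point-separated : ∀ k w w′ → Ball (s * t ^ k) (λ c → point k w c - point k w′ c) →
                      ∀ i → w i ≡ w′ i
    point-separated (suc k) w w′ near = λ { Fin.zero → w₀≡w′₀ ; (Fin.suc i) → point-separated k (w ∘ Fin.suc) (w′ ∘ Fin.suc) tails i }
      where
      p p′ : Vector ℚ d
      p  = point k (w ∘ Fin.suc)
      p′ = point k (w′ ∘ Fin.suc)

      -- The difference of the centres is that of the two points plus t times a difference of inner
      -- points, which both lie in the ball of radius ρ.
      heads : Ball (t * (ρ + ρ) + s) (λ c → y (w Fin.zero) c - y (w′ Fin.zero) c)
      heads = Ball-mono
        (ℚ.<⇒≤ (+-pos 0<t2ρ (0<st^ (suc k))))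
        (ℚ.+-monoʳ-≤ (t * (ρ + ρ)) (st^≤s (suc k)))
        (Ball-cong (λ c → solve 5 (λ t a b p q → t :* (q :+ :- p) :+ ((a :+ t :* p) :- (b :+ t :* q))
                                                 := a :- b)
                            refl t (y (w Fin.zero) c) (y (w′ Fin.zero) c) (p c) (p′ c))
          (Ball-+ 0<t2ρ (0<st^ (suc k))
            (Ball-scale t (Ball-+ 0<ρ 0<ρ (point∈Ball k _)
              (Ball-neg (point∈Ball k _))))
            near))
        where
        0<t2ρ : 0ℚ < t * (ρ + ρ)
        0<t2ρ = *-pos 0<t (+-pos 0<ρ 0<ρ)

      w₀≡w′₀ : w Fin.zero ≡ w′ Fin.zero
      w₀≡w′₀ = separated _ _ heads

      tails : Ball (s * t ^ k) (λ c → p c - p′ c)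
      tails = Ball-unscale 0<t (subst (λ a → Ball a (λ c → t * (p c - p′ c)))
        (solve 3 (λ s t u → s :* (t :* u) := t :* (s :* u)) refl s t (t ^ k))
        (Ball-cong (λ c → trans (cong (λ i → y (w Fin.zero) c + t * p c - (y i c + t * p′ c)) (sym w₀≡w′₀))
            (solve 4 (λ t a p q → (a :+ t :* p) :- (a :+ t :* q) := t :* (p :- q))
              refl t (y (w Fin.zero) c) (p c) (p′ c)))
          near))

    -- The side h is fixed by d h = s t^k, so that points sharing a cell are close enough for
    -- `point-separated`.
    module Grid (k : ℕ) {h : ℚ} (0<h : 0ℚ < h) (dh≡st^k : d · h ≡ s * t ^ k) where

      M : ℕ
      M = proj₁ (floor 0<h (ℚ.<⇒≤ (+-pos 0<ρ 0<ρ)))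

      -- Adding ρ moves the coordinates into [0, 2ρ], so cells are numbered by naturals from 0 to
      -- `M`.
      shifted : (Fin k → Fin m) → Vector ℚ d
      shifted w c = point k w c + ρ

      0≤shifted : ∀ w c → 0ℚ ≤ shifted w c
      0≤shifted w c = subst (0ℚ ≤_) (solve 2 (λ x ρ → ρ :- :- x := x :+ ρ) refl (point k w c) ρ)
        (p≤q⇒0≤q-p (Ball⇒coord≤ (ℚ.<⇒≤ 0<ρ)
          (Ball-neg (point∈Ball k w)) c))

      index : (Fin k → Fin m) → Fin d → ℕ
      index w c = proj₁ (floor 0<h (0≤shifted w c))

      index-lower : ∀ w c → index w c · h ≤ shifted w c
      index-lower w c = proj₁ (proj₂ (floor 0<h (0≤shifted w c)))

      index-upper : ∀ w c → shifted w c < suc (index w c) · h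
      index-upper w c = proj₂ (proj₂ (floor 0<h (0≤shifted w c)))

      index≤M : ∀ w c → index w c ℕ.≤ M
      index≤M w c = ℕ.≮⇒≥ λ M<index → ℚ.<-irrefl refl (begin-strict
        ρ + ρ            <⟨ proj₂ (proj₂ (floor 0<h (ℚ.<⇒≤ (+-pos 0<ρ 0<ρ)))) ⟩
        suc M · h        ≤⟨ ·-monoˡ-≤ (ℚ.<⇒≤ 0<h) M<index ⟩
        index w c · h    ≤⟨ index-lower w c ⟩
        point k w c + ρ  ≤⟨ ℚ.+-monoˡ-≤ ρ (Ball⇒coord≤ (ℚ.<⇒≤ 0<ρ) (point∈Ball k w) c) ⟩
        ρ + ρ            ∎)
        where open ≤R

      cell : (Fin k → Fin m) → Fin d → Fin (suc M)
      cell w c = fromℕ< (ℕ.s≤s (index≤M w c))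

      cell-injective : ∀ w w′ → (∀ c → cell w c ≡ cell w′ c) → ∀ i → w i ≡ w′ i
      cell-injective w w′ eq = point-separated k w w′
        (subst (λ a → Ball a (λ c → point k w c - point k w′ c)) dh≡st^k
          (cube⇒Ball (ℚ.<⇒≤ 0<h) λ c →
            subst (λ x → x * x ≤ h * h)
              (solve 3 (λ p q ρ → p :+ ρ :- (q :+ ρ) := p :- q) refl (point k w c) (point k w′ c) ρ)
              (cells-close {index w c} (index-lower w c) (index-upper w c)
                (subst (λ n → n · h ≤ shifted w′ c) (sym (same c)) (index-lower w′ c))
                (subst (λ n → shifted w′ c < suc n · h) (sym (same c)) (index-upper w′ c)))))
        where
        same : ∀ c → index w c ≡ index w′ c
        same c = Fin.fromℕ<-injective (index w c) (index w′ c) _ _ (eq c)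

      -- Pigeonhole. `cell` is injective only up to pointwise equality; coding words and cells as
      -- numbers turns this into genuine injectivity.
      m^k≤[1+M]^d : m ℕ.^ k ℕ.≤ suc M ℕ.^ d
      m^k≤[1+M]^d = Fin.injective⇒≤ {f = funToFin ∘ cell ∘ finToFun} λ {a} {b} eq →
        finToFun-injective (cell-injective (finToFun a) (finToFun b) λ c →
          trans (sym (Fin.finToFun-funToFin (cell (finToFun a)) c))
            (trans (cong (λ i → finToFun i c) eq) (Fin.finToFun-funToFin (cell (finToFun b)) c)))
        where
        funToFin-cong : ∀ {j n} {f g : Fin j → Fin n} → (∀ i → f i ≡ g i) → funToFin f ≡ funToFin g
        funToFin-cong {zero}  f≗g = refl
        funToFin-cong {suc j} f≗g = cong₂ Fin.combine (f≗g Fin.zero) (funToFin-cong (f≗g ∘ Fin.suc))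

        finToFun-injective : {a b : Fin (m ℕ.^ k)} → (∀ i → finToFun {m} {k} a i ≡ finToFun b i) → a ≡ b
        finToFun-injective {a} {b} a≗b = trans (sym (Fin.funToFin-finToFin {k} {m} a))
          (trans (funToFin-cong a≗b) (Fin.funToFin-finToFin {k} {m} b))

    -- An upper bound for (M + 1) · d h at every k, since M h ≤ 2ρ and d h = s t^k ≤ s.
    C : ℚ
    C = ι d * (ρ + ρ) + s

    -- Multiplying `m^k≤[1+M]^d` by (s t^k)^d = (d h)^d replaces the growing number of cells by the
    -- d-th power of the bounded length (M + 1) · d h.
    grid-bound : ∀ k → (ι m * t ^ d) ^ k * s ^ d ≤ C ^ d
    grid-bound k with h , 0<h , ιdh≡st^k ← scale {ι d} (0<ι d) (0<st^ k) = begin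
      (ι m * t ^ d) ^ k * s ^ d
        ≡⟨ cong (_* s ^ d) (^-distrib-* (ι m) (t ^ d) k) ⟩
      (ι m) ^ k * (t ^ d) ^ k * s ^ d
        ≡⟨ cong (λ x → (ι m) ^ k * x * s ^ d)
             (trans (^-assocʳ t d k) (trans (cong (t ^_) (ℕ.*-comm d k)) (sym (^-assocʳ t k d)))) ⟩
      (ι m) ^ k * (t ^ k) ^ d * s ^ d
        ≡⟨ solve 3 (λ a b c → a :* b :* c := a :* (c :* b)) refl ((ι m) ^ k) ((t ^ k) ^ d) (s ^ d) ⟩
      (ι m) ^ k * (s ^ d * (t ^ k) ^ d)
        ≡⟨ cong₂ _*_ (sym (ι-^ m k)) (sym (^-distrib-* s (t ^ k) d)) ⟩
      ι (m ℕ.^ k) * (s * t ^ k) ^ d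
        ≤⟨ *-monoʳ-≤ (^-nonNeg d (ℚ.<⇒≤ (0<st^ k))) (·-monoˡ-≤ (ℚ.<⇒≤ 0<1) m^k≤[1+M]^d) ⟩
      ι (suc M ℕ.^ d) * (s * t ^ k) ^ d
        ≡⟨ cong (_* (s * t ^ k) ^ d) (ι-^ (suc M) d) ⟩
      (ι (suc M)) ^ d * (s * t ^ k) ^ d
        ≡⟨ ^-distrib-* (ι (suc M)) (s * t ^ k) d ⟨
      (ι (suc M) * (s * t ^ k)) ^ d
        ≤⟨ ^-mono-≤ d (*-nonNeg (0≤· (suc M) (ℚ.<⇒≤ 0<1)) (ℚ.<⇒≤ (0<st^ k))) cells ⟩
      C ^ d
        ∎
      where
      open ≤R
      open Grid k 0<h (trans (·≡ι* d h) ιdh≡st^k)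
      cells : ι (suc M) * (s * t ^ k) ≤ C
      cells = begin
        ι (suc M) * (s * t ^ k)
          ≡⟨ cong (ι (suc M) *_) ιdh≡st^k ⟨
        (1ℚ + ι M) * (ι d * h)
          ≡⟨ solve 3 (λ a b c → (con 1ℚ :+ a) :* (b :* c) := b :* (a :* c) :+ b :* c) refl (ι M) (ι d) h ⟩
        ι d * (ι M * h) + ι d * h
          ≡⟨ cong₂ (λ a b → ι d * a + b) (sym (·≡ι* M h)) ιdh≡st^k ⟩
        ι d * (M · h) + s * t ^ k
          ≤⟨ ℚ.+-mono-≤
               (*-monoˡ-≤ (ℚ.<⇒≤ (0<ι d)) (proj₁ (proj₂ (floor 0<h (ℚ.<⇒≤ (+-pos 0<ρ 0<ρ))))))
               (st^≤s k) ⟩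
        C
          ∎

    packing : ι m * t ^ d ≤ 1ℚ
    packing = bounded-powers⇒≤1 (^-pos d 0<s) grid-bound

  -- The packing bound, exact and with errors.

  ^-mono-< : ∀ {p q} n .{{_ : NonZero n}} → 0ℚ ≤ p → p < q → p ^ n < q ^ n
  ^-mono-< {p} {q} (suc n) 0≤p p<q = ℚ.≤-<-trans
    (*-monoˡ-≤ 0≤p (^-mono-≤ n 0≤p (ℚ.<⇒≤ p<q)))
    (ℚ.*-monoˡ-<-pos (q ^ n) {{positive (^-pos n (ℚ.≤-<-trans 0≤p p<q))}} p<q)

  ^-cancel-≤ : ∀ {p q} n .{{_ : NonZero n}} → 0ℚ ≤ q → p ^ n ≤ q ^ n → p ≤ q
  ^-cancel-≤ n 0≤q p^n≤q^n = ℚ.≮⇒≥ λ q<p →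
    ℚ.<-irrefl refl (ℚ.<-≤-trans (^-mono-< n 0≤q q<p) p^n≤q^n)

  -- The two equations for ρ and t are solved by ρ = R + δ/2 and t = δ / (2ρ); multiplying m t^d ≤ 1
  -- by (2ρ)^d clears the denominator.
  packing-bound : ∀ {d m} .{{_ : NonZero d}} (y : Vector (Vector ℚ d) m) {R δ s} →
    0ℚ < R → 0ℚ < δ → 0ℚ < s → (∀ i → Ball R (y i)) →
    (∀ i j → Ball (δ + s) (λ c → y i c - y j c) → i ≡ j) →
    ι m * δ ^ d ≤ (δ + (R + R)) ^ d
  packing-bound {d} {m} y {R} {δ} {s} 0<R 0<δ 0<s y∈R separated
    with t , 0<t , ρt≡½δ ← scale {R + ½ * δ} (+-pos 0<R (half-pos 0<δ)) (half-pos 0<δ) = begin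
      ι m * δ ^ d                           ≡⟨ cong (λ x → ι m * x ^ d) t2ρ≡δ ⟨
      ι m * (t * (ρ + ρ)) ^ d               ≡⟨ cong (ι m *_) (^-distrib-* t (ρ + ρ) d) ⟩
      ι m * (t ^ d * (ρ + ρ) ^ d)           ≡⟨ ℚ.*-assoc (ι m) (t ^ d) ((ρ + ρ) ^ d) ⟨
      ι m * t ^ d * (ρ + ρ) ^ d             ≤⟨ *-monoʳ-≤ (^-nonNeg d (ℚ.<⇒≤ (+-pos 0<ρ 0<ρ)))
                                                 (SelfSimilar.packing y {ρ = ρ} 0<R 0<ρ 0<t t≤1 0<s R+tρ≡ρ y∈R
                                                   (λ i j → separated i j ∘ subst (λ a → Ball (a + s) _) t2ρ≡δ)) ⟩
      1ℚ * (ρ + ρ) ^ d                      ≡⟨ ℚ.*-identityˡ ((ρ + ρ) ^ d) ⟩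
      (ρ + ρ) ^ d                           ≡⟨ cong (_^ d) 2ρ≡ ⟩
      (δ + (R + R)) ^ d                     ∎
    where
    open ≤R
    ρ = R + ½ * δ
    0<ρ : 0ℚ < ρ
    0<ρ = +-pos 0<R (half-pos 0<δ)
    2ρ≡ : ρ + ρ ≡ δ + (R + R)
    2ρ≡ = trans (solve 2 (λ a b → a :+ b :+ (a :+ b) := b :+ b :+ (a :+ a)) refl R (½ * δ))
      (cong (_+ (R + R)) (half+half δ))
    R+tρ≡ρ : R + t * ρ ≡ ρ
    R+tρ≡ρ = cong (λ x → R + x) (trans (ℚ.*-comm t ρ) ρt≡½δ)
    t2ρ≡δ : t * (ρ + ρ) ≡ δ
    t2ρ≡δ = trans (solve 2 (λ t r → t :* (r :+ r) := r :* t :+ r :* t) refl t ρ)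
      (trans (cong₂ _+_ ρt≡½δ ρt≡½δ) (half+half δ))
    t≤1 : t ≤ 1ℚ
    t≤1 = *-cancelˡ-≤ 0<ρ (begin
      ρ * t         ≡⟨ ρt≡½δ ⟩
      ½ * δ         ≡⟨ ℚ.+-identityˡ (½ * δ) ⟨
      0ℚ + ½ * δ    ≤⟨ ℚ.+-monoˡ-≤ (½ * δ) (ℚ.<⇒≤ 0<R) ⟩
      ρ             ≡⟨ ℚ.*-identityʳ ρ ⟨
      ρ * 1ℚ        ∎)

  -- Either a ≤ 1 or a ≤ a^d. A crude bound suffices, as it only multiplies an error; it must depend
  -- on m alone, because `a` will vary with the index.
  root-bound : ∀ d {m} .{{_ : NonZero d}} {a} → a ^ d ≤ ι m → a - 1ℚ ≤ ι (suc m)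
  root-bound d {m} {a} a^d≤m = ℚ.≤-trans a-1≤a a≤1+m
    where
    a-1≤a : a - 1ℚ ≤ a
    a-1≤a = subst (a - 1ℚ ≤_) (ℚ.+-identityʳ a) (ℚ.+-monoʳ-≤ a (ℚ.neg-antimono-≤ (ℚ.<⇒≤ 0<1)))
    m≤1+m : ι m ≤ ι (suc m)
    m≤1+m = ·-monoˡ-≤ (ℚ.<⇒≤ 0<1) (ℕ.n≤1+n m)
    a≤1+m : a ≤ ι (suc m)
    a≤1+m with ℚ.≤-total 1ℚ a
    ... | inj₁ 1≤a = ℚ.≤-trans (1≤p⇒p≤p^n d 1≤a) (ℚ.≤-trans a^d≤m m≤1+m)
    ... | inj₂ a≤1 = ℚ.≤-trans a≤1 (p≤p+q (0≤· m (ℚ.<⇒≤ 0<1)))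

  -- The separation is only known up to e; shrinking δ by 3 e leaves the slack s = e.
  radius-bound : ∀ {d m} .{{_ : NonZero d}} (y : Vector (Vector ℚ d) m) {R δ e a} →
    0ℚ < R → 0ℚ ≤ δ → 0ℚ < e → 0ℚ ≤ a → a ^ d ≤ ι m → (∀ i → Ball R (y i)) →
    (e + e + e ≤ δ → ∀ i j → Ball (δ - (e + e)) (λ c → y i c - y j c) → i ≡ j) →
    (a - 1ℚ) * δ ≤ R + R + ι (suc m) * (e + e + e)
  radius-bound {d} {m} y {R} {δ} {e} {a} 0<R 0≤δ 0<e 0≤a a^d≤m y∈R separated
    with ℚ.≤-total δ (e + e + e)
  ... | inj₁ δ≤3e = begin
    (a - 1ℚ) * δ                         ≤⟨ *-monoʳ-≤ 0≤δ (root-bound d {m} {a} a^d≤m) ⟩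
    ι (suc m) * δ                        ≤⟨ *-monoˡ-≤ (0≤· (suc m) (ℚ.<⇒≤ 0<1)) δ≤3e ⟩
    ι (suc m) * (e + e + e)              ≡⟨ ℚ.+-identityˡ (ι (suc m) * (e + e + e)) ⟨
    0ℚ + ι (suc m) * (e + e + e)         ≤⟨ ℚ.+-monoˡ-≤ (ι (suc m) * (e + e + e)) (ℚ.<⇒≤ (+-pos 0<R 0<R)) ⟩
    R + R + ι (suc m) * (e + e + e)      ∎
    where open ≤R
  -- Packing controls a δ′ - δ′; the rest, (a - 1) · 3e, is pure error.
  ... | inj₂ 3e≤δ = begin
    (a - 1ℚ) * δ
      ≡⟨ solve 3 (λ a δ t → (a :- con 1ℚ) :* δ
                            := a :* (δ :- t) :- (δ :- t) :+ (a :- con 1ℚ) :* t) refl a δ (e + e + e) ⟩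
    a * δ′ - δ′ + (a - 1ℚ) * (e + e + e)
      ≤⟨ ℚ.+-mono-≤ (ℚ.+-monoˡ-≤ (- δ′) aδ′≤) (*-monoʳ-≤ 0≤3e (root-bound d {m} {a} a^d≤m)) ⟩
    δ′ + (R + R) - δ′ + ι (suc m) * (e + e + e)
      ≡⟨ cong (_+ ι (suc m) * (e + e + e)) (solve 2 (λ δ r → δ :+ r :- δ := r) refl δ′ (R + R)) ⟩
    R + R + ι (suc m) * (e + e + e)
      ∎
    where
    open ≤R
    δ′ = δ - (e + e + e)
    0≤3e : 0ℚ ≤ e + e + e
    0≤3e = ℚ.<⇒≤ (+-pos (+-pos 0<e 0<e) 0<e)
    0≤δ′ : 0ℚ ≤ δ′
    0≤δ′ = p≤q⇒0≤q-p 3e≤δ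
    δ′+e≡ : δ′ + e ≡ δ - (e + e)
    δ′+e≡ = solve 2 (λ δ e → δ :- (e :+ e :+ e) :+ e := δ :- (e :+ e)) refl δ e
    0≤δ′+2R : 0ℚ ≤ δ′ + (R + R)
    0≤δ′+2R = ℚ.+-mono-≤ 0≤δ′ (ℚ.<⇒≤ (+-pos 0<R 0<R))
    aδ′≤ : a * δ′ ≤ δ′ + (R + R)
    aδ′≤ with 0ℚ ℚ.<? δ′
    -- The case δ′ = 0, out of reach of `packing-bound`: the left side is at most 0.
    ... | no  0≮δ′ = ℚ.≤-trans (subst (a * δ′ ≤_) (ℚ.*-zeroʳ a) (*-monoˡ-≤ 0≤a (ℚ.≮⇒≥ 0≮δ′))) 0≤δ′+2R
    ... | yes 0<δ′ = ^-cancel-≤ d 0≤δ′+2R (begin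
      (a * δ′) ^ d          ≡⟨ ^-distrib-* a δ′ d ⟩
      a ^ d * δ′ ^ d        ≤⟨ *-monoʳ-≤ (^-nonNeg d 0≤δ′) a^d≤m ⟩
      ι m * δ′ ^ d          ≤⟨ packing-bound y 0<R 0<δ′ 0<e y∈R
                                 (λ i j → separated 3e≤δ i j ∘ subst (λ b → Ball b _) δ′+e≡) ⟩
      (δ′ + (R + R)) ^ d    ∎)

  ι≃ : ∀ n → toℚᵘ (ι n) ℚᵘ.≃ ℚᵘ.mkℚᵘ (ℤ.+ n) 0
  ι≃ zero    = ℚᵘ.≃-refl
  ι≃ (suc n) = ℚᵘ.≃-trans (ℚ.toℚᵘ-homo-+ 1ℚ (ι n)) (ℚᵘ.≃-trans (ℚᵘ.+-congʳ (toℚᵘ 1ℚ) (ι≃ n))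
    (ℚᵘ.*≡* (cong (λ m → (ℤ.+ 1 ℤ.+ m) ℤ.* ℤ.+ 1) (ℤ.*-identityʳ (ℤ.+ n)))))

  /-*-ι : ∀ a b .{{_ : NonZero b}} → (ℤ.+ a / b) * ι b ≡ ι a
  /-*-ι a b@(suc b-1) = ℚ.toℚᵘ-injective (begin
    toℚᵘ ((ℤ.+ a / b) * ι b)                     ≈⟨ ℚ.toℚᵘ-homo-* (ℤ.+ a / b) (ι b) ⟩
    toℚᵘ (ℤ.+ a / b) ℚᵘ.* toℚᵘ (ι b)             ≈⟨ ℚᵘ.*-cong (ℚ.toℚᵘ-fromℚᵘ (ℚᵘ.mkℚᵘ (ℤ.+ a) b-1)) (ι≃ b) ⟩
    ℚᵘ.mkℚᵘ (ℤ.+ a) b-1 ℚᵘ.* ℚᵘ.mkℚᵘ (ℤ.+ b) 0   ≈⟨ ℚᵘ.*≡* (ℤ.*-assoc (ℤ.+ a) (ℤ.+ b) (ℤ.+ 1)) ⟩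
    ℚᵘ.mkℚᵘ (ℤ.+ a) 0                            ≈⟨ ι≃ a ⟨
    toℚᵘ (ι a)                                   ∎)
    where open ℚᵘ.≃-Reasoning

  quotient≤ι : ∀ {a b m} .{{_ : NonZero b}} → a ℕ.≤ m ℕ.* b → ℤ.+ a / b ≤ ι m
  quotient≤ι {a} {b} {m} a≤mb = ℚ.*-cancelʳ-≤-pos (ι b) {{positive (0<ι b)}}
    (subst₂ _≤_ (sym (/-*-ι a b)) (×1-homo-* m b) (·-monoˡ-≤ (ℚ.<⇒≤ 0<1) a≤mb))

open import Defs hiding (module RationalLemmas)

-- From Cauchy sequences to rational inequalities at late indices.

module Reals where

  open RationalLemmas
  open Packing using (∣_∣²; Ball; ball; Ball-cong; Ball-neg; 0≤∣∣²; p²≤q²⇒p≤q)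
  open import Data.Rational.Solver using (module +-*-Solver)
  open +-*-Solver using (solve; _:=_; _:+_; _:-_; :-_)

  Eventually : (ℕ → Set) → Set
  Eventually P = ∃[ K ] (∀ k → K ℕ.≤ k → P k)

  eventually-∀ : ∀ {n} {P : Fin n → ℕ → Set} → (∀ i → Eventually (P i)) →
                 Eventually (λ k → ∀ i → P i k)
  eventually-∀ {zero}  P = 0 , λ _ _ ()
  eventually-∀ {suc n} P =
    let K , P₀ = P Fin.zero
        L , Pₛ = eventually-∀ (P ∘ Fin.suc)
    in K ℕ.⊔ L , λ k ≤k → λ
      { Fin.zero    → P₀ k (ℕ.m⊔n≤o⇒m≤o K L ≤k)
      ; (Fin.suc i) → Pₛ k (ℕ.m⊔n≤o⇒n≤o K L ≤k) i }

  small-difference : ∀ y x z e → ℚ.∣ (y ℚ.- x) ℚ.- z ∣ ℚ.< ½ ℚ.* e → z ℚ.≤ ½ ℚ.* e → y ℚ.≤ x ℚ.+ e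
  small-difference y x z e near z≤½e = begin
    y                                  ≡⟨ solve 2 (λ y x → y := x :+ (y :- x)) refl y x ⟩
    x ℚ.+ (y ℚ.- x)                    ≤⟨ ℚ.+-monoʳ-≤ x (ℚ.<⇒≤ (near⇒< (y ℚ.- x) z near)) ⟩
    x ℚ.+ (z ℚ.+ ½ ℚ.* e)              ≤⟨ ℚ.+-monoʳ-≤ x (ℚ.+-monoˡ-≤ (½ ℚ.* e) z≤½e) ⟩
    x ℚ.+ (½ ℚ.* e ℚ.+ ½ ℚ.* e)        ≡⟨ cong (x ℚ.+_) (half+half e) ⟩
    x ℚ.+ e                            ∎
    where open ≤R

  large-difference : ∀ y x z e → ℚ.∣ (y ℚ.- x) ℚ.- z ∣ ℚ.< e → e ℚ.< z → x ℚ.≤ y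
  large-difference y x z e near e<z = begin
    x                                  ≡⟨ solve 2 (λ x e → x := x :+ e :- e) refl x e ⟩
    x ℚ.+ e ℚ.- e                      ≤⟨ ℚ.+-monoˡ-≤ (ℚ.- e) (ℚ.+-monoʳ-≤ x (ℚ.<⇒≤ e<z)) ⟩
    x ℚ.+ z ℚ.- e                      ≤⟨ ℚ.+-monoˡ-≤ (ℚ.- e) (ℚ.+-monoʳ-≤ x (ℚ.<⇒≤ (near⇒> (y ℚ.- x) z near))) ⟩
    x ℚ.+ (y ℚ.- x ℚ.+ e) ℚ.- e        ≡⟨ solve 3 (λ x y e → x :+ (y :- x :+ e) :- e := y) refl x y e ⟩
    y                                  ∎
    where open ≤R

  -- Constructively valid because one rational decides. Let z be the term of y - x at an index after
  -- which it varies by less than e/2. If z > e/2, then x ≤ y from there on, a contradiction;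
  -- otherwise y ≤ x + e from there on.
  ≰⇒≥ : ∀ x y → ¬ x ≤ y → y ≤ x
  ≰⇒≥ x y x≰y e 0<e = K , λ k K≤k →
    small-difference (seq y k) (seq x k) (seq (y - x) K) e (close k K K≤k ℕ.≤-refl) (ℚ.≮⇒≥ ½e≮z)
    where
    K = proj₁ (cauchy (y - x) (½ ℚ.* e) (half-pos 0<e))
    close = proj₂ (cauchy (y - x) (½ ℚ.* e) (half-pos 0<e))

    ½e≮z : ¬ (½ ℚ.* e ℚ.< seq (y - x) K)
    ½e≮z ½e<z = x≰y λ ε 0<ε → K , λ k K≤k → ℚ.≤-trans
      (large-difference (seq y k) (seq x k) (seq (y - x) K) (½ ℚ.* e) (close k K K≤k ℕ.≤-refl) ½e<z)
      (p≤p+q (ℚ.<⇒≤ 0<ε))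

  0<x⇒eventually-nonNeg : ∀ {x} → 0ℝ < x → Eventually (λ k → 0ℚ ℚ.≤ seq x k)
  0<x⇒eventually-nonNeg (ε , 0<ε , K , ≥ε) =
    K , λ k K≤k → ℚ.≤-trans (subst (0ℚ ℚ.≤_) (sym (ℚ.+-identityˡ ε)) (ℚ.<⇒≤ 0<ε)) (≥ε k K≤k)

  root-approx : ∀ d .{{_ : NonZero d}} x k → ApproxRoot d (seq x k ℚ.⊔ 0ℚ) (1/suc k) (seq (root d x) k)
  root-approx d x k = proj₂ (approxRoot d (ℚ.p≤q⊔p (seq x k) 0ℚ) (1/suc-pos k))

  infix 9 _at_
  _at_ : ∀ {d} → Vector ℝ d → ℕ → Vector ℚ d
  (v at k) c = seq (v c) k

  sum-of-squares-at : ∀ {d} (v : Vector ℝ d) k → seq (sum (map (λ a → a * a) v)) k ≡ ∣ v at k ∣²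
  sum-of-squares-at {zero}  v k = refl
  sum-of-squares-at {suc d} v k = cong (seq (v Fin.zero) k ℚ.* seq (v Fin.zero) k ℚ.+_)
    (sum-of-squares-at (v ∘ Fin.suc) k)

  -- The truncation at 0 built into `root` does not affect a sum of squares.
  norm-approx : ∀ {d} (v : Vector ℝ d) k → ApproxRoot 2 (∣ v at k ∣²) (1/suc k) (seq ∥ v ∥₂ k)
  norm-approx v k = subst (λ q → ApproxRoot 2 q (1/suc k) (seq ∥ v ∥₂ k))
    (trans (cong (ℚ._⊔ 0ℚ) (sum-of-squares-at v k)) (ℚ.p≥q⇒p⊔q≡p (0≤∣∣² (v at k))))
    (root-approx 2 (sum (map (λ a → a * a) v)) k)

  square : ∀ p → p ^ 2 ≡ p ℚ.* p
  square p = cong (p ℚ.*_) (ℚ.*-identityʳ p)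

  norm-nonNeg : ∀ {d} (v : Vector ℝ d) k → 0ℚ ℚ.≤ seq ∥ v ∥₂ k
  norm-nonNeg v k = proj₁ (norm-approx v k)

  norm²≤∣∣² : ∀ {d} (v : Vector ℝ d) k → seq ∥ v ∥₂ k ℚ.* seq ∥ v ∥₂ k ℚ.≤ ∣ v at k ∣²
  norm²≤∣∣² v k = subst (ℚ._≤ ∣ v at k ∣²) (square (seq ∥ v ∥₂ k)) (proj₁ (proj₂ (norm-approx v k)))

  -- The rational root falls short by less than 1/(k+1). Bounding the vector costs this much,
  -- whereas `norm²≤∣∣²` is free of error.
  at∈Ball : ∀ {d} (v : Vector ℝ d) k → Ball (seq ∥ v ∥₂ k ℚ.+ 1/suc k) (v at k)
  at∈Ball v k = ball (subst (∣ v at k ∣² ℚ.≤_) (square (seq ∥ v ∥₂ k ℚ.+ 1/suc k))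
    (ℚ.<⇒≤ (proj₂ (proj₂ (norm-approx v k)))))

  seq≤foldr-⊔ : ∀ {n} b (v : Vector ℝ n) i k → seq (v i) k ℚ.≤ seq (foldr _⊔_ b v) k
  seq≤foldr-⊔ b v Fin.zero    k = ℚ.p≤p⊔q (seq (v Fin.zero) k) _
  seq≤foldr-⊔ b v (Fin.suc i) k = ℚ.≤-trans (seq≤foldr-⊔ b (v ∘ Fin.suc) i k) (ℚ.p≤q⊔p (seq (v Fin.zero) k) _)

  base≤foldr-⊔ : ∀ {n} b (v : Vector ℝ n) k → seq b k ℚ.≤ seq (foldr _⊔_ b v) k
  base≤foldr-⊔ {zero}  b v k = ℚ.≤-refl
  base≤foldr-⊔ {suc n} b v k = ℚ.≤-trans (base≤foldr-⊔ b (v ∘ Fin.suc) k) (ℚ.p≤q⊔p (seq (v Fin.zero) k) _)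

  seq≤max : ∀ {n} .{{_ : NonZero n}} (v : Vector ℝ n) i k → seq (v i) k ℚ.≤ seq (max v) k
  seq≤max {suc n} v Fin.zero    k = base≤foldr-⊔ (v Fin.zero) (v ∘ Fin.suc) k
  seq≤max {suc n} v (Fin.suc i) k = seq≤foldr-⊔ (v Fin.zero) (v ∘ Fin.suc) i k

  max-nonNeg : ∀ {n} .{{_ : NonZero n}} (v : Vector ℝ n) k → (∀ i → 0ℚ ℚ.≤ seq (v i) k) →
               0ℚ ℚ.≤ seq (max v) k
  max-nonNeg {suc n} v k 0≤v = ℚ.≤-trans (0≤v Fin.zero) (seq≤max v Fin.zero k)

  -- Absence from `xs` refutes nearness, and `≰⇒≥` turns that into a lower bound on the distance, up
  -- to e, at late indices. Finitely many pairs share one such index.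
  eventually-separated : ∀ {d n} (x : Vector (Vector ℝ d) n) δ xs → (∀ p → p ∈ xs ⇔ NearPair x δ p) →
    ∀ e → 0ℚ ℚ.< e → Eventually (λ k → ∀ u v → u ≢ v → (u , v) ∉ xs → (v , u) ∉ xs →
      0ℚ ℚ.≤ seq δ k ℚ.- (e ℚ.+ e) → ¬ Ball (seq δ k ℚ.- (e ℚ.+ e)) (λ c → seq (x u c) k ℚ.- seq (x v c) k))
  eventually-separated {d} {n} x δ xs ∈⇔near e 0<e =
    let K , K-far = eventually-∀ {P = λ u k → ∀ v → Far u v k} (λ u → eventually-∀ {P = Far u} (far u))
    in K , λ k K≤k → separated k (K-far k K≤k)
    where
    open DecMembership (≡-dec (Fin._≟_ {n}) (Fin._≟_ {n})) using (_∈?_)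

    Far : Fin n → Fin n → ℕ → Set
    Far u v k = u Fin.< v → (u , v) ∉ xs → seq δ k ℚ.≤ seq ∥ x u -ᵛ x v ∥₂ k ℚ.+ e

    far : ∀ u v → Eventually (Far u v)
    far u v = decide ((u , v) ∈? xs) (u Fin.<? v)
      where
      decide : Dec ((u , v) ∈ xs) → Dec (u Fin.< v) → Eventually (Far u v)
      decide (yes uv∈xs) _         = 0 , λ _ _ _ uv∉xs → contradiction uv∈xs uv∉xs
      decide (no  _)     (no  u≮v) = 0 , λ _ _ u<v → contradiction u<v u≮v
      decide (no  uv∉xs) (yes u<v) =
        let K , δ≤ = ≰⇒≥ ∥ x u -ᵛ x v ∥₂ δ (λ near → uv∉xs (Equivalence.from (∈⇔near (u , v)) (u<v , near))) e 0<e
        in K , λ k K≤k _ _ → δ≤ k K≤k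

    module _ (k : ℕ) (far : ∀ u v → Far u v k) where
      b = seq δ k ℚ.- (e ℚ.+ e)

      ordered : ∀ u v → u Fin.< v → (u , v) ∉ xs → 0ℚ ℚ.≤ b →
                ¬ Ball b (λ c → seq (x u c) k ℚ.- seq (x v c) k)
      -- One e covers the approximate lower bound on the norm s, the other makes the contradiction
      -- strict: δ ≤ s + e ≤ δ - e < δ.
      ordered u v u<v uv∉xs 0≤b (ball ≤b²) = ℚ.<-irrefl refl (begin-strict
        seq δ k                 ≤⟨ far u v u<v uv∉xs ⟩
        s ℚ.+ e                 ≤⟨ ℚ.+-monoˡ-≤ e (p²≤q²⇒p≤q {s} {b} 0≤b (ℚ.≤-trans (norm²≤∣∣² (x u -ᵛ x v) k) ≤b²)) ⟩
        b ℚ.+ e                 <⟨ ℚ.+-monoʳ-< b (subst (ℚ._< e ℚ.+ e) (ℚ.+-identityˡ e) (ℚ.+-monoˡ-< e 0<e)) ⟩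
        b ℚ.+ (e ℚ.+ e)         ≡⟨ solve 2 (λ δ e → δ :- e :+ e := δ) refl (seq δ k) (e ℚ.+ e) ⟩
        seq δ k                 ∎)
        where
        open ≤R
        s = seq ∥ x u -ᵛ x v ∥₂ k

      separated : ∀ u v → u ≢ v → (u , v) ∉ xs → (v , u) ∉ xs → 0ℚ ℚ.≤ b →
                  ¬ Ball b (λ c → seq (x u c) k ℚ.- seq (x v c) k)
      separated u v u≢v uv∉ vu∉ 0≤b uv∈b = by-trichotomy (Fin.<-cmp u v)
        where
        by-trichotomy : ¬ Tri (u Fin.< v) (u ≡ v) (v Fin.< u)
        by-trichotomy (tri< u<v _ _) = ordered u v u<v uv∉ 0≤b uv∈b
        by-trichotomy (tri≈ _ u≡v _) = u≢v u≡v
        by-trichotomy (tri> _ _ v<u) = ordered v u v<u vu∉ 0≤b (Ball-cong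
          (λ c → solve 2 (λ p q → :- (p :- q) := q :- p) refl (seq (x u c) k) (seq (x v c) k)) (Ball-neg uv∈b))

  -- The final error budget: halving leaves one η, at most ε/2, and half of the ε.
  halve : ∀ {a δ M η ε} → η ℚ.≤ ½ ℚ.* ε → (a ℚ.- 1ℚ) ℚ.* δ ℚ.≤ M ℚ.+ η ℚ.+ (M ℚ.+ η) ℚ.+ ε →
          ½ ℚ.* (a ℚ.- 1ℚ) ℚ.* δ ℚ.≤ M ℚ.+ ε
  halve {a} {δ} {M} {η} {ε} η≤ bound = begin
    ½ ℚ.* (a ℚ.- 1ℚ) ℚ.* δ                      ≡⟨ ℚ.*-assoc ½ (a ℚ.- 1ℚ) δ ⟩
    ½ ℚ.* ((a ℚ.- 1ℚ) ℚ.* δ)                    ≤⟨ ℚ.*-monoˡ-≤-nonNeg ½ bound ⟩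
    ½ ℚ.* (M ℚ.+ η ℚ.+ (M ℚ.+ η) ℚ.+ ε)         ≡⟨ trans (ℚ.*-distribˡ-+ ½ (M ℚ.+ η ℚ.+ (M ℚ.+ η)) ε)
                                                     (cong (ℚ._+ ½ ℚ.* ε) (trans (ℚ.*-distribˡ-+ ½ (M ℚ.+ η) (M ℚ.+ η))
                                                       (half+half (M ℚ.+ η)))) ⟩
    M ℚ.+ η ℚ.+ ½ ℚ.* ε                         ≤⟨ ℚ.+-monoˡ-≤ (½ ℚ.* ε) (ℚ.+-monoʳ-≤ M η≤) ⟩
    M ℚ.+ ½ ℚ.* ε ℚ.+ ½ ℚ.* ε                   ≡⟨ ℚ.+-assoc M (½ ℚ.* ε) (½ ℚ.* ε) ⟩
    M ℚ.+ (½ ℚ.* ε ℚ.+ ½ ℚ.* ε)                 ≡⟨ cong (M ℚ.+_) (half+half ε) ⟩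
    M ℚ.+ ε                                     ∎
    where open ≤R

-- Assembly at a common late index.

open import Data.Integer.Base using (+_)
open Reals
open Turán
open Packing using (ι_; 0<ι; 0≤·; +-pos; p≤q⇒0≤q-p; Ball; Ball-mono; Ball-cong; radius-bound; quotient≤ι)
open RationalLemmas using (0<1; p≤p+q; scale; half-pos; 1/suc; 1/suc-pos; 1/suc-vanishes)

theorem1 : ∀ (d n : ℕ) .{{_ : NonZero d}} .{{_ : NonZero n}}
    (r β : ℝ) → 0ℝ < r → 0ℝ < β →
    (x : Vector (Vector ℝ d) n) (N : ℕ) → ∣ NearPair x (β * r) ∣≡ N →
    (x₀ : Vector ℝ d) →
    fromℚ ½ * (root d (fromℚ (+ (n ℕ.^ 2) ℚ./ (2 ℕ.* N ℕ.+ n))) - 1ℝ) * (β * r)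
    ≤ max (λ i → ∥ x i -ᵛ x₀ ∥₂)
theorem1 d n r β 0<r 0<β x _ (xs , _ , ∈⇔near , refl) x₀ ε 0<ε =
    K₁ ℕ.⊔ K₂ ℕ.⊔ (K₃ ℕ.⊔ K₄) , λ k K≤k →
    let K₁₂≤k = ℕ.m⊔n≤o⇒m≤o (K₁ ℕ.⊔ K₂) (K₃ ℕ.⊔ K₄) K≤k
        K₃₄≤k = ℕ.m⊔n≤o⇒n≤o (K₁ ℕ.⊔ K₂) (K₃ ℕ.⊔ K₄) K≤k
    in at-index k
         (proj₂ separated k (ℕ.m⊔n≤o⇒m≤o K₁ K₂ K₁₂≤k))
         (proj₂ r-nonNeg k (ℕ.m⊔n≤o⇒n≤o K₁ K₂ K₁₂≤k))
         (proj₂ β-nonNeg k (ℕ.m⊔n≤o⇒m≤o K₃ K₄ K₃₄≤k))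
         (ℚ.<⇒≤ (proj₂ η-small k (ℕ.m⊔n≤o⇒n≤o K₃ K₄ K₃₄≤k)))
  where
  open EdgeList (Fin._≟_ {n})
  open RationalLemmas using (_^_; *-nonNeg)
  open import Data.Rational.Solver using (module +-*-Solver)
  open +-*-Solver using (solve; _:=_; _:+_; _:*_; _:-_)

  family = turán (weight xs) (weight-refl xs) (List.allFin n)
  m = proj₁ family
  f = proj₁ (proj₂ family)
  f-far = proj₁ (proj₂ (proj₂ (proj₂ family)))
  n²≤ = proj₂ (proj₂ (proj₂ (proj₂ family)))

  B : ℚ
  B = ι (suc m)

  -- e solves 3 (m + 1) e = ε, so that the error term of `radius-bound` is exactly ε; m is known
  -- before any index is chosen.
  tolerance = scale (+-pos (+-pos (0<ι (suc m)) (0<ι (suc m))) (0<ι (suc m))) 0<ε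
  e = proj₁ tolerance
  0<e = proj₁ (proj₂ tolerance)
  3Be≡ε = proj₂ (proj₂ tolerance)

  separated = eventually-separated x (β * r) xs ∈⇔near e 0<e
  r-nonNeg = 0<x⇒eventually-nonNeg {r} 0<r
  β-nonNeg = 0<x⇒eventually-nonNeg {β} 0<β
  η-small = 1/suc-vanishes (half-pos 0<ε)
  K₁ = proj₁ separated
  K₂ = proj₁ r-nonNeg
  K₃ = proj₁ β-nonNeg
  K₄ = proj₁ η-small

  q : ℚ
  q = + (n ℕ.^ 2) ℚ./ (2 ℕ.* length xs ℕ.+ n)

  q≤m : q ℚ.≤ ι m
  q≤m = quotient≤ι {m = m} (begin
    n ℕ.^ 2                                              ≡⟨ cong (n ℕ.*_) (ℕ.*-identityʳ n) ⟩
    n ℕ.* n                                              ≡⟨ cong (λ l → l ℕ.* l) (List.length-tabulate {n = n} (λ i → i)) ⟨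
    length (List.allFin n) ℕ.* length (List.allFin n)    ≤⟨ n²≤ ⟩
    m ℕ.* totalDegree (weight xs) (List.allFin n)        ≤⟨ ℕ.*-monoʳ-≤ m (totalDegree-weight (allFin⁺ n) xs) ⟩
    m ℕ.* (2 ℕ.* length xs ℕ.+ length (List.allFin n))   ≡⟨ cong (λ l → m ℕ.* (2 ℕ.* length xs ℕ.+ l))
                                                              (List.length-tabulate {n = n} (λ i → i)) ⟩
    m ℕ.* (2 ℕ.* length xs ℕ.+ n)                        ∎)
    where open ℕ.≤-Reasoning

  at-index : ∀ k →
    (∀ u v → u ≢ v → (u , v) ∉ xs → (v , u) ∉ xs → 0ℚ ℚ.≤ seq (β * r) k ℚ.- (e ℚ.+ e) →
      ¬ Ball (seq (β * r) k ℚ.- (e ℚ.+ e)) (λ c → seq (x u c) k ℚ.- seq (x v c) k)) →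
    0ℚ ℚ.≤ seq r k → 0ℚ ℚ.≤ seq β k → 1/suc k ℚ.≤ ½ ℚ.* ε →
    ½ ℚ.* (seq (root d (fromℚ q)) k ℚ.- 1ℚ) ℚ.* (seq β k ℚ.* seq r k)
      ℚ.≤ seq (max (λ i → ∥ x i -ᵛ x₀ ∥₂)) k ℚ.+ ε
  at-index k separated 0≤r 0≤β η≤½ε = halve {a} {δ} {M} η≤½ε
    (subst (λ t → (a ℚ.- 1ℚ) ℚ.* δ ℚ.≤ R ℚ.+ R ℚ.+ t) B3e≡ε
      (radius-bound y {a = a} 0<R (*-nonNeg 0≤β 0≤r) 0<e 0≤a a^d≤m y∈R y-separated))
    where
    a = seq (root d (fromℚ q)) k
    δ = seq β k ℚ.* seq r k
    M = seq (max (λ i → ∥ x i -ᵛ x₀ ∥₂)) k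
    -- The summand 1/(k+1) pays for `at∈Ball` and keeps R positive even if every norm vanishes.
    R = M ℚ.+ 1/suc k

    y : Vector (Vector ℚ d) m
    y i c = seq (x (f i) c) k ℚ.- seq (x₀ c) k

    B3e≡ε : B ℚ.* (e ℚ.+ e ℚ.+ e) ≡ ε
    B3e≡ε = trans (solve 2 (λ B e → B :* (e :+ e :+ e) := (B :+ B :+ B) :* e) refl B e) 3Be≡ε

    0<R : 0ℚ ℚ.< R
    0<R = ℚ.+-mono-≤-< (max-nonNeg (λ i → ∥ x i -ᵛ x₀ ∥₂) k (λ i → norm-nonNeg (x i -ᵛ x₀) k)) (1/suc-pos k)

    0≤a : 0ℚ ℚ.≤ a
    0≤a = proj₁ (root-approx d (fromℚ q) k)

    -- The approximate root errs downwards, which is the useful direction; the maximum with 0 comes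
    -- from `root`.
    a^d≤m : a ^ d ℚ.≤ ι m
    a^d≤m = ℚ.≤-trans (proj₁ (proj₂ (root-approx d (fromℚ q) k))) (ℚ.⊔-lub q≤m (0≤· m (ℚ.<⇒≤ 0<1)))

    y∈R : ∀ i → Ball R (y i)
    y∈R i = Ball-mono (ℚ.+-mono-≤ (norm-nonNeg (x (f i) -ᵛ x₀) k) (ℚ.<⇒≤ (1/suc-pos k)))
      (ℚ.+-monoˡ-≤ (1/suc k) (seq≤max (λ i → ∥ x i -ᵛ x₀ ∥₂) (f i) k))
      (at∈Ball (x (f i) -ᵛ x₀) k)

    y-separated : e ℚ.+ e ℚ.+ e ℚ.≤ δ → ∀ i j →
                  Ball (δ ℚ.- (e ℚ.+ e)) (λ c → y i c ℚ.- y j c) → i ≡ j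
    y-separated 3e≤δ i j yij∈ = by-trichotomy (Fin.<-cmp i j)
      where
      xij∈ : Ball (δ ℚ.- (e ℚ.+ e)) (λ c → seq (x (f i) c) k ℚ.- seq (x (f j) c) k)
      xij∈ = Ball-cong (λ c → solve 3 (λ a b o → a :- o :- (b :- o) := a :- b) refl
        (seq (x (f i) c) k) (seq (x (f j) c) k) (seq (x₀ c) k)) yij∈

      0≤δ-2e : 0ℚ ℚ.≤ δ ℚ.- (e ℚ.+ e)
      0≤δ-2e = p≤q⇒0≤q-p (ℚ.≤-trans (p≤p+q (ℚ.<⇒≤ 0<e)) 3e≤δ)

      -- The order of i and j says nothing about that of f i and f j, so both orientations must be
      -- absent from `xs`.
      by-trichotomy : Tri (i Fin.< j) (i ≡ j) (j Fin.< i) → i ≡ j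
      by-trichotomy (tri≈ _ i≡j _) = i≡j
      by-trichotomy (tri< i<j _ _) = contradiction xij∈ (separated (f i) (f j) (weight≡0⇒≢ xs w≡0)
        (weight≡0⇒∉ xs w≡0) (weight≡0⇒swap∉ xs w≡0) 0≤δ-2e)
        where w≡0 = f-far i j i<j
      by-trichotomy (tri> _ _ j<i) = contradiction xij∈ (separated (f i) (f j) (weight≡0⇒≢ xs w≡0 ∘ sym)
        (weight≡0⇒swap∉ xs w≡0) (weight≡0⇒∉ xs w≡0) 0≤δ-2e)
        where w≡0 = f-far j i j<i
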